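{- Let $X$ be a stacked simplicial complex of dimension $d$ with vertex set $V$ and facet set $F$, and let $r\ge1$ and $s\ge1$ be integers. Then the maps $\Phi$ and $\Psi$ restrict to mutually inverse bijections between the set of partitions of $V$ into $r+d$ non-empty parts, each part being $(s+1)$-scattered, and the set of partitions of $F$ into $r$ non-empty parts, each part being $s$-scattered.
   Context: A simplicial complex $X$ on a finite vertex set $V$ is a family of subsets (faces) of $V$ closed under taking subsets, every element of $V$ lying in some face; facets are inclusion-maximal faces. $X$ is pure of dimension $d$ if every facet has $d+1$ elements; a codimension one face is a face with $d$ elements. $X$ is stacked if it is pure of some dimension $d$ and its facets can be ordered $F_0,\dots,F_k$ such that for each $p\ge1$, $F_p$ contains exactly one vertex $v_p$ not in $F_0\cup\dots\cup F_{p-1}$, and $F_p\setminus\{v_p\}\subseteq F_j$ for some $j<p$. A walk is a sequence of facets $f_1,\dots,f_p$ ($p\ge1$) with each $f_i\cap f_{i+1}$ of exactly $d$ elements; a path is a walk in which the faces $f_i\cap f_{i+1}$, $1\le i<p$, are pairwise distinct; in a stacked complex there is a unique path between any two facets. For faces $h,k$ with $h\cup k$ not contained in any codimension one face, a path between $h$ and $k$, written $h\,|\,f_1,\dots,f_p\,|\,k$, is a path with $h\subseteq f_1$, $k\subseteq f_p$ and, if $p\ge2$, $h\not\subseteq f_1\cap f_2$, $k\not\subseteq f_p\cap f_{p-1}$; in a stacked complex it exists and is unique. Distances: for facets $f,g$, $\mathrm{dist}(f,g)$ is the minimal $p-1$ over walks $f_1,\dots,f_p$ with $f_1=f$, $f_p=g$;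 for distinct vertices $v,w$, $\mathrm{dist}(v,w)$ is the minimal $p\ge1$ such that there is a walk $f_1,\dots,f_p$ with $v\in f_1$, $w\in f_p$. A set of vertices (resp. facets) is $s$-scattered if any two distinct elements have distance $\ge s$; an independent set of vertices is a $2$-scattered one. The map $\Phi$ (vertex partitions into independent sets $\to$ facet partitions): given such a partition $\mathcal V$ of $V$, for distinct facets $f,f'$ with unique path $f=f_1,\dots,f_p=f'$, let $v$ be the element of $f_1\setminus f_2$ and $w$ the element of $f_p\setminus f_{p-1}$; set $f\sim'_F f'$ iff $v,w$ lie in the same part $P$ of $\mathcal V$ and none of $f_2,\dots,f_{p-1}$ contains a vertex of $P$; $\Phi(\mathcal V)$ is the partition of $F$ into classes of the equivalence relation generated by $\sim'_F$. The map $\Psi$ (facet partitions $\to$ vertex partitions): given a partition $\mathcal F$ of $F$, for distinct vertices $v,w$ not lying in a common facet, with unique path $v\,|\,f_1,\dots,f_p\,|\,w$, set $v\sim'_V w$ iff $f_1,f_p$ lie in the same part $Q$ of $\mathcal F$ and none of $f_2,\dots,f_{p-1}$ lies in $Q$; $\Psi(\mathcal F)$ is the partition of $V$ into classes of the equivalence relation generated by $\sim'_V$. -}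

module Defs where

open import Data.Fin.Base using (Fin; suc; inject₁; _<_)
open import Data.Fin.Subset using (Subset; _∈_; _∉_; _⊆_; _⊈_; _∩_; _∪_; _─_; _-_; ⁅_⁆; ∣_∣)
open import Data.Nat.Base using (ℕ; zero; suc; _+_; _≤_)
open import Data.Product.Base using (Σ-syntax; ∃; ∃₂; _×_; proj₁)
open import Data.Refinement using (Refinement; value)
open import Data.Unit.Base using (⊤)
open import Data.Vec.Functional using (Vector; head; last; tail; init)
open import Function.Base using (id; _∘_)
open import Function.Bundles using (Bijection; _⤖_; _⇔_; mk⇔)
open import Function.Definitions using (Injective)
import Function.Construct.Composition as Compose
import Function.Construct.Symmetry as Symmetry
open import Level using (0ℓ) renaming (suc to lsuc)
open import Relation.Binary.Bundles using (Setoid)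
open import Relation.Binary.Construct.Closure.Equivalence as EqClosure using (EqClosure)
open import Relation.Binary.Core using (Rel)
open import Relation.Binary.PropositionalEquality using (_≡_; _≢_)
import Relation.Binary.PropositionalEquality as ≡
open import Relation.Binary.Structures using (IsEquivalence)
open import Relation.Nullary.Negation using (¬_)
open import Relation.Unary using (Pred; Decidable)

-- A partition of A is given by the relation "in the same part".
record Partition (A : Set) : Set₁ where
  infix 4 _~_
  field
    _~_           : Rel A 0ℓ
    isEquivalence : IsEquivalence _~_

  quotient : Setoid 0ℓ 0ℓ
  quotient = record { isEquivalence = isEquivalence }

generatedBy : ∀ {A : Set} → Rel A 0ℓ → Partition A
generatedBy R = record { _~_ = EqClosure R ; isEquivalence = EqClosure.isEquivalence R }

infix 4 _≋_
_≋_ : ∀ {A : Set} → Partition A → Partition A → Set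
P ≋ Q = ∀ x y → (x P.~ y) ⇔ (x Q.~ y)
  where
  module P = Partition P
  module Q = Partition Q

HasParts : ∀ {A : Set} → ℕ → Partition A → Set
HasParts m P = Bijection (Partition.quotient P) (≡.setoid (Fin m))

IsMinimum : Pred ℕ 0ℓ → Pred ℕ 0ℓ
IsMinimum P k = P k × (∀ {j} → P j → k ≤ j)

-- The distance is passed as a relation: Dist x y k says that it equals k.
Scattered : ∀ {A : Set} → (A → A → Pred ℕ 0ℓ) → ℕ → Partition A → Set
Scattered Dist s P = ∀ {x y} → x ~ y → x ≢ y → ∃ λ k → Dist x y k × s ≤ k
  where open Partition P

ScatteredPartitions : ∀ {A : Set} → (A → A → Pred ℕ 0ℓ) → ℕ → ℕ → Setoid (lsuc 0ℓ) 0ℓ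
ScatteredPartitions {A} Dist m s = record
  { Carrier       = Σ[ P ∈ Partition A ] HasParts m P × Scattered Dist s P
  ; _≈_           = λ P Q → proj₁ P ≋ proj₁ Q
  ; isEquivalence = record
    { refl  = λ _ _ → mk⇔ id id
    ; sym   = λ e x y → Symmetry.equivalence (e x y)
    ; trans = λ e e′ x y → Compose.equivalence (e x y) (e′ x y)
    }
  }

record SimplicialComplex (n : ℕ) : Set₁ where
  field
    Face      : Pred (Subset n) 0ℓ
    face?     : Decidable Face
    ⊆-closed  : ∀ {f g} → g ⊆ f → Face f → Face g
    covers    : ∀ v → ∃ λ f → Face f × v ∈ f

  IsFacet : Pred (Subset n) 0ℓ
  IsFacet f = Face f × (∀ {g} → Face g → f ⊆ g → g ⊆ f)

  -- The proof of IsFacet is irrelevant, so propositional equality of facets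
  -- is equality of the underlying vertex sets.
  Facet : Set
  Facet = Refinement (Subset n) IsFacet

module _ {n : ℕ} (X : SimplicialComplex n) where
  open SimplicialComplex X

  record Stacked (d : ℕ) : Set where
    field
      pure  : ∀ (f : Facet) → ∣ value f ∣ ≡ suc d
      {k}   : ℕ
      order : Fin (suc k) ⤖ Facet

    F : Fin (suc k) → Subset n
    F = value ∘ Bijection.to order

    New : Fin (suc k) → Pred (Fin n) 0ℓ
    New p v = v ∈ F p × (∀ {j} → j < p → v ∉ F j)

    field
      attach : ∀ (i : Fin k) → let p = suc i in
               ∃ λ v → New p v × (∀ {w} → New p w → w ≡ v)
                     × ∃ λ j → j < p × F p - v ⊆ F j

module _ {n : ℕ} (X : SimplicialComplex n) (d : ℕ) where
  open SimplicialComplex X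

  -- The entry at i is the intersection of the i-th and the next facet.
  ridges : ∀ {m} → Vector Facet (suc m) → Vector (Subset n) m
  ridges fs i = value (fs (inject₁ i)) ∩ value (fs (suc i))

  IsWalk : ∀ {m} → Vector Facet (suc m) → Set
  IsWalk fs = ∀ i → ∣ ridges fs i ∣ ≡ d

  IsPath : ∀ {m} → Vector Facet (suc m) → Set
  IsPath fs = IsWalk fs × Injective _≡_ _≡_ (ridges fs)

  LeavesEnds : Subset n → Subset n → ∀ {m} → Vector Facet (suc m) → Set
  LeavesEnds h k {zero}  fs = ⊤
  LeavesEnds h k {suc m} fs = h ⊈ head (ridges fs) × k ⊈ last (ridges fs)

  record IsPathBetween (h k : Subset n) {m : ℕ} (fs : Vector Facet (suc m)) : Set where
    field
      not-in-ridge : ∀ {c} → Face c → ∣ c ∣ ≡ d → (h ∪ k) ⊈ c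
      isPath       : IsPath fs
      starts       : h ⊆ value (head fs)
      ends         : k ⊆ value (last fs)
      leavesEnds   : LeavesEnds h k fs

  FacetWalk : Facet → Facet → Pred ℕ 0ℓ
  FacetWalk f g m = Σ[ fs ∈ Vector Facet (suc m) ] IsWalk fs × head fs ≡ f × last fs ≡ g

  FacetDist : Facet → Facet → Pred ℕ 0ℓ
  FacetDist f g = IsMinimum (FacetWalk f g)

  -- Facet distance counts steps, whereas vertex distance counts the facets
  -- of the walk.
  VertexWalk : Fin n → Fin n → Pred ℕ 0ℓ
  VertexWalk v w p = ∃ λ m → p ≡ suc m ×
    Σ[ fs ∈ Vector Facet (suc m) ] IsWalk fs × v ∈ value (head fs) × w ∈ value (last fs)

  VertexDist : Fin n → Fin n → Pred ℕ 0ℓ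
  VertexDist v w = IsMinimum (VertexWalk v w)

  VertexPartitions : ℕ → ℕ → Setoid (lsuc 0ℓ) 0ℓ
  VertexPartitions = ScatteredPartitions VertexDist

  FacetPartitions : ℕ → ℕ → Setoid (lsuc 0ℓ) 0ℓ
  FacetPartitions = ScatteredPartitions FacetDist

  interior : ∀ {m} → Vector Facet (2 + m) → Vector Facet m
  interior fs = tail (init fs)

  -- In both relations below the path is unique when X is stacked, so asking
  -- for some path with the required property is asking it of the path.  It has
  -- at least two facets: the two ends are distinct facets in the first case,
  -- and the two vertices share no facet in the second.

  FacetLink : Partition (Fin n) → Rel Facet 0ℓ
  FacetLink 𝒱 f f′ = f ≢ f′ ×
    ∃ λ m → Σ[ fs ∈ Vector Facet (2 + m) ]
      IsPath fs × head fs ≡ f × last fs ≡ f′ ×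
      ∃₂ λ v w → v ∈ value (head fs) ─ value (head (tail fs))
               × w ∈ value (last fs) ─ value (last (init fs))
               × v ~ w
               × (∀ i {u} → u ∈ value (interior fs i) → ¬ v ~ u)
    where open Partition 𝒱

  VertexLink : Partition Facet → Rel (Fin n) 0ℓ
  VertexLink 𝓕 v w = v ≢ w × ¬ (∃ λ (f : Facet) → v ∈ value f × w ∈ value f) ×
    ∃ λ m → Σ[ fs ∈ Vector Facet (2 + m) ]
      IsPathBetween ⁅ v ⁆ ⁅ w ⁆ fs
      × head fs ~ last fs
      × (∀ i → ¬ head fs ~ interior fs i)
    where open Partition 𝓕

  -- The formula for Φ makes sense for every vertex partition; it is applied
  -- to partitions into independent sets.
  Φ : Partition (Fin n) → Partition Facet
  Φ 𝒱 = generatedBy (FacetLink 𝒱)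

  Ψ : Partition Facet → Partition (Fin n)
  Ψ 𝓕 = generatedBy (VertexLink 𝓕)

{-# OPTIONS --safe #-}

-- Give the vertex parts colours and the facet parts labels.  The bijection is
-- controlled by maps Θ f, one for each facet f, from colours to labels: the
-- colours on f go to the label of f, the other colours correspond bijectively
-- to the other labels, and if f and g are adjacent then Θ f and Θ g agree on
-- every colour missing from the ridge f ∩ g.  When facets are attached one by
-- one, a labelling extends along each new facet g with new vertex v: if h is an
-- earlier facet sharing the ridge, the label of g is Θ h (colour of v), so the
-- colour of v and the label of g determine each other.
--
-- Along a walk from f to f′ that leaves the vertex v and enters the vertex w,
-- the value Θ (colour of v) stays equal to the label of f as long as the colour
-- of v does not occur, equivalently as long as the label of f does not recur.
-- Hence the links defining Φ and those defining Ψ occur along the same paths,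
-- which gives both the identification of Φ and Ψ and the comparison of distances.

module Submission where

open import Defs
open import Data.Bool.Base using (if_then_else_)
open import Data.Bool.Properties as Bool using ()
open import Data.Empty using (⊥-elim)
open import Data.Fin.Base as Fin using (Fin; zero; suc; inject₁; fromℕ; toℕ; punchIn; punchOut)
open import Data.Fin.Induction using (Acc; acc; <-wellFounded; <-weakInduction)
open import Data.Fin.Properties as Fin using (any?; toℕ-injective; toℕ<n)
open import Data.Fin.Relation.Unary.Top using (view; ‵fromℕ; ‵inj₁)
open import Data.Fin.Subset using (Subset; inside; outside; _∈_; _∉_; _⊆_; _∩_; _∪_; _─_; _-_; ⁅_⁆; ∣_∣)
open import Data.Fin.Subset.Properties
open import Data.Irrelevant using ([_])
open import Data.Nat.Base using (ℕ; zero; suc; _+_; _≤_; _<_; s≤s; s≤s⁻¹)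
open import Data.Nat.Properties as ℕ using (≤-trans; ≤-refl)
open import Data.Product.Base using (Σ-syntax; ∃; _×_; _,_; proj₁; proj₂)
open import Data.Refinement as Refinement using (value)
open import Data.Refinement.Properties using (value-injective)
open import Data.Sum.Base using (_⊎_; inj₁; inj₂; [_,_]′)
open import Data.Vec.Base using ([]; _∷_; here; there)
open import Data.Vec.Functional using (Vector; head; last; tail; init) renaming (_∷_ to _◂_)
open import Data.Vec.Properties using (≡-dec)
open import Function.Base using (id; _∘_; _$_; case_of_)
open import Function.Bundles using (Bijection; Inverse; Equivalence; mk⇔)
import Function.Construct.Composition as Compose
import Function.Construct.Symmetry as Symmetry
open import Function.Definitions using (Injective)
open import Level using (0ℓ)
open import Relation.Binary.Bundles using (Setoid)
open import Relation.Binary.Construct.Closure.Equivalence as EqClosure using (EqClosure)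
open import Relation.Binary.Construct.Closure.ReflexiveTransitive as Star using (Star; ε; _◅_; _◅◅_)
open import Relation.Binary.Construct.Closure.Symmetric as SymClosure using ()
import Relation.Binary.Construct.On as On
open import Relation.Binary.Core using (Rel)
open import Relation.Binary.Definitions using (DecidableEquality; tri<; tri≈; tri>)
open import Relation.Binary.PropositionalEquality
open import Relation.Binary.Structures using (IsEquivalence)
open import Relation.Nullary.Decidable using (Dec; yes; no; does; _×-dec_; ¬?; map′; dec-true; dec-false)
open import Relation.Nullary.Negation using (¬_; contradiction)
open import Relation.Unary using (Pred; Decidable)

private
  variable
    A B : Set
    n κ ρ : ℕ

-- Cardinalities and enumerations of finite subsets.

∣p∣≡∣p∩q∣+∣p─q∣ : ∀ (p q : Subset n) → ∣ p ∣ ≡ ∣ p ∩ q ∣ + ∣ p ─ q ∣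
∣p∣≡∣p∩q∣+∣p─q∣ []            []            = refl
∣p∣≡∣p∩q∣+∣p─q∣ (outside ∷ p) (outside ∷ q) = ∣p∣≡∣p∩q∣+∣p─q∣ p q
∣p∣≡∣p∩q∣+∣p─q∣ (outside ∷ p) (inside ∷ q)  = ∣p∣≡∣p∩q∣+∣p─q∣ p q
∣p∣≡∣p∩q∣+∣p─q∣ (inside ∷ p)  (outside ∷ q) =
  trans (cong suc (∣p∣≡∣p∩q∣+∣p─q∣ p q)) (sym (ℕ.+-suc _ _))
∣p∣≡∣p∩q∣+∣p─q∣ (inside ∷ p)  (inside ∷ q)  = cong suc (∣p∣≡∣p∩q∣+∣p─q∣ p q)

x∈p⇒⁅x⁆⊆p : ∀ {x} {p : Subset n} → x ∈ p → ⁅ x ⁆ ⊆ p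
x∈p⇒⁅x⁆⊆p {x = x} {p} x∈p y∈x = subst (_∈ p) (sym (x∈⁅y⁆⇒x≡y x y∈x)) x∈p

x∈p─q⇒x∉q : ∀ (p q : Subset n) {x} → x ∈ p ─ q → x ∉ q
x∈p─q⇒x∉q (_ ∷ p) (inside ∷ q)  {suc x} (there m) (there m′) = x∈p─q⇒x∉q p q m m′
x∈p─q⇒x∉q (_ ∷ p) (outside ∷ q) {suc x} (there m) (there m′) = x∈p─q⇒x∉q p q m m′

p⊆q∧∣p∣≡∣q∣⇒q⊆p : ∀ {p q : Subset n} → p ⊆ q → ∣ p ∣ ≡ ∣ q ∣ → q ⊆ p
p⊆q∧∣p∣≡∣q∣⇒q⊆p {p = p} p⊆q eq {x} x∈q with x ∈? p
... | yes x∈p = x∈p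
... | no  x∉p = contradiction (p⊂q⇒∣p∣<∣q∣ (p⊆q , x , x∈q , x∉p)) (ℕ.<-irrefl eq)

elements : ∀ (p : Subset n) → ∃ λ (e : Fin ∣ p ∣ → Fin n) →
  Injective _≡_ _≡_ e × (∀ i → e i ∈ p) × (∀ {x} → x ∈ p → ∃ λ i → e i ≡ x)
elements [] = (λ ()) , (λ {}) , (λ ()) , λ ()
elements (outside ∷ p) with elements p
... | e , e-inj , e∈p , e-surj =
  suc ∘ e , e-inj ∘ Fin.suc-injective , there ∘ e∈p ,
  λ { (there x∈p) → let i , eq = e-surj x∈p in i , cong suc eq }
elements {suc n} (inside ∷ p) with elements p
... | e , e-inj , e∈p , e-surj = e′ , e′-inj , e′∈ , e′-surj
  where
  e′ : Fin (suc ∣ p ∣) → Fin (suc n)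
  e′ zero    = zero
  e′ (suc i) = suc (e i)
  e′-inj : Injective _≡_ _≡_ e′
  e′-inj {zero}  {zero}  _  = refl
  e′-inj {suc i} {suc j} eq = cong suc (e-inj (Fin.suc-injective eq))
  e′∈ : ∀ i → e′ i ∈ inside ∷ p
  e′∈ zero    = here
  e′∈ (suc i) = there (e∈p i)
  e′-surj : ∀ {x} → x ∈ inside ∷ p → ∃ λ i → e′ i ≡ x
  e′-surj here        = zero , refl
  e′-surj (there x∈p) = let i , eq = e-surj x∈p in suc i , cong suc eq

enumerate : ∀ (p : Subset n) {m} → ∣ p ∣ ≡ m → ∃ λ (e : Fin m → Fin n) →
  Injective _≡_ _≡_ e × (∀ i → e i ∈ p) × (∀ {x} → x ∈ p → ∃ λ i → e i ≡ x)
enumerate p refl = elements p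

∣p∣≡1⇒unique : ∀ {p : Subset n} → ∣ p ∣ ≡ 1 → ∃ λ a → a ∈ p × (∀ {x} → x ∈ p → x ≡ a)
∣p∣≡1⇒unique {p = p} eq with enumerate p eq
... | e , _ , e∈p , e-surj =
  e zero , e∈p zero , λ x∈p → case e-surj x∈p of λ { (zero , eq) → sym eq }

-- By counting, `p ─ q` has exactly one element. For adjacent facets it is the vertex of `p`
-- opposite to the common ridge.
apex : ∀ {d} (p q : Subset n) → ∣ p ∣ ≡ suc d → ∣ p ∩ q ∣ ≡ d →
  ∃ λ a → a ∈ p × a ∉ q × (∀ {x} → x ∈ p → x ∉ q → x ≡ a)
apex {d = d} p q ∣p∣ ∣p∩q∣ with ∣p∣≡1⇒unique {p = p ─ q} (sym (ℕ.+-cancelˡ-≡ d 1 ∣ p ─ q ∣ (begin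
    d + 1                   ≡⟨ ℕ.+-comm d 1 ⟩
    suc d                   ≡⟨ ∣p∣ ⟨
    ∣ p ∣                   ≡⟨ ∣p∣≡∣p∩q∣+∣p─q∣ p q ⟩
    ∣ p ∩ q ∣ + ∣ p ─ q ∣   ≡⟨ cong (_+ ∣ p ─ q ∣) ∣p∩q∣ ⟩
    d + ∣ p ─ q ∣           ∎)))
  where open ≡-Reasoning
... | a , a∈ , uniq = a , p─q⊆p p q a∈ , x∈p─q⇒x∉q p q a∈ , λ x∈p x∉q → uniq (x∈p∧x∉q⇒x∈p─q x∈p x∉q)

∣p-x∣ : ∀ {d} (p : Subset n) {x} → x ∈ p → ∣ p ∣ ≡ suc d → ∣ p - x ∣ ≡ d
∣p-x∣ {d = d} p {x} x∈p ∣p∣ = ℕ.≤-antisym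
  (s≤s⁻¹ (≤-trans (x∈p⇒∣p-x∣<∣p∣ x∈p) (ℕ.≤-reflexive ∣p∣)))
  (s≤s⁻¹ (begin
    suc d                          ≡⟨ ∣p∣ ⟨
    ∣ p ∣                          ≡⟨ ∣p∣≡∣p∩q∣+∣p─q∣ p ⁅ x ⁆ ⟩
    ∣ p ∩ ⁅ x ⁆ ∣ + ∣ p - x ∣      ≤⟨ ℕ.+-monoˡ-≤ _ (∣p∩q∣≤∣q∣ p ⁅ x ⁆) ⟩
    ∣ ⁅ x ⁆ ∣ + ∣ p - x ∣          ≡⟨ cong (_+ ∣ p - x ∣) (∣⁅x⁆∣≡1 x) ⟩
    suc ∣ p - x ∣                  ∎))
  where open ℕ.≤-Reasoning

least : ∀ {P : Pred ℕ 0ℓ} → Decidable P → ∀ {m} → P m → ∃ (IsMinimum P)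
least {P} P? {m} Pm = case below (suc m) of λ
  { (inj₁ none) → ⊥-elim (none ≤-refl Pm)
  ; (inj₂ min)  → min
  }
  where
  below : ∀ b → (∀ {j} → j < b → ¬ P j) ⊎ ∃ (IsMinimum P)
  below zero    = inj₁ λ ()
  below (suc b) with below b | P? b
  ... | inj₂ min  | _      = inj₂ min
  ... | inj₁ none | yes Pb = inj₂ (b , Pb , λ Pj → ℕ.≮⇒≥ λ j<b → none j<b Pj)
  ... | inj₁ none | no ¬Pb = inj₁ λ j<1+b Pj → case ℕ.m<1+n⇒m<n∨m≡n j<1+b of λ
    { (inj₁ j<b)  → none j<b Pj
    ; (inj₂ refl) → ¬Pb Pj
    }

-- Each induction step assigns a value to the facet or vertex just attached and leaves the earlier
-- values alone.
module Override (_≟_ : DecidableEquality A) where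

  override : (A → B) → A → B → (A → B)
  override f a b x = if does (x ≟ a) then b else f x

  override-same : ∀ (f : A → B) a b → override f a b a ≡ b
  override-same f a b rewrite dec-true (a ≟ a) refl = refl

  override-other : ∀ (f : A → B) a b {x} → x ≢ a → override f a b x ≡ f x
  override-other f a b {x} x≢a rewrite dec-false (x ≟ a) x≢a = refl

-- Maps from colours to labels that contract one set of colours.

record Collapses (S : Pred (Fin κ) 0ℓ) (t : Fin ρ) (θ : Fin κ → Fin ρ) : Set where
  field
    on⇒     : ∀ {c} → S c → θ c ≡ t
    ⇒on     : ∀ {c} → θ c ≡ t → S c
    -- With the other fields, this makes `θ` a bijection from the colours outside `S` to the labels
    -- other than `t`.
    off-inj : ∀ {c c′} → θ c ≡ θ c′ → c ≡ c′ ⊎ θ c ≡ t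
    surj    : ∀ u → ∃ λ c → θ c ≡ u

Collapses-resp : ∀ {S T : Pred (Fin κ) 0ℓ} {t : Fin ρ} {θ} →
  (∀ {c} → S c → T c) → (∀ {c} → T c → S c) → Collapses S t θ → Collapses T t θ
Collapses-resp S⇒T T⇒S col = record
  { on⇒ = on⇒ ∘ T⇒S ; ⇒on = S⇒T ∘ ⇒on ; off-inj = off-inj ; surj = surj }
  where open Collapses col

-- Induction on `d`: identifying two colours in the image of `g` removes one colour from the whole
-- set and one from the image. For `d` zero the image is a single colour and the identity works.
collapse : ∀ d {m} → m ≡ ρ + d → (g : Fin (suc d) → Fin m) → Injective _≡_ _≡_ g →
  ∃ λ (t : Fin ρ) → ∃ (Collapses (λ c → ∃ λ i → g i ≡ c) t)
collapse {ρ} zero m≡ g g-inj with refl ← trans m≡ (ℕ.+-identityʳ ρ) = g zero , id , record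
  { on⇒     = λ { (zero , eq) → sym eq }
  ; ⇒on     = λ eq → zero , sym eq
  ; off-inj = inj₁
  ; surj    = λ u → u , refl
  }
collapse {ρ} (suc d) m≡ g g-inj with refl ← trans m≡ (ℕ.+-suc ρ d) = result
  where
  a : Fin (suc (ρ + d))
  a = g zero

  a≢g : ∀ i → a ≢ g (suc i)
  a≢g i eq = case g-inj eq of λ ()

  -- π identifies g 0 with g 1.
  merge : ∀ {x} → Dec (a ≡ x) → Fin (ρ + d)
  merge (yes _)  = punchOut (a≢g zero)
  merge (no a≢x) = punchOut a≢x

  π : Fin (suc (ρ + d)) → Fin (ρ + d)
  π x = merge (a Fin.≟ x)

  π-a : π a ≡ π (g (suc zero))
  π-a with a Fin.≟ a | a Fin.≟ g (suc zero)
  ... | no a≢a | _      = contradiction refl a≢a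
  ... | yes _  | yes eq = contradiction eq (a≢g zero)
  ... | yes _  | no _   = Fin.punchOut-cong a refl

  π-inj : ∀ {x y} → a ≢ x → a ≢ y → π x ≡ π y → x ≡ y
  π-inj {x} {y} a≢x a≢y eq with a Fin.≟ x | a Fin.≟ y
  ... | yes a≡x | _       = contradiction a≡x a≢x
  ... | no _    | yes a≡y = contradiction a≡y a≢y
  ... | no a≢x  | no a≢y  = Fin.punchOut-injective a≢x a≢y eq

  π-surj : ∀ y → π (punchIn a y) ≡ y
  π-surj y with a Fin.≟ punchIn a y
  ... | yes eq = contradiction (sym eq) (Fin.punchInᵢ≢i a y)
  ... | no _   = trans (Fin.punchOut-cong a refl) (Fin.punchOut-punchIn a)

  result : ∃ λ t → ∃ (Collapses (λ c → ∃ λ i → g i ≡ c) t)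
  -- The tail of `g` avoids `a`, and `π` is injective off `a`.
  result with collapse d refl (π ∘ g ∘ suc) (λ {i} {j} eq → Fin.suc-injective (g-inj (π-inj (a≢g i) (a≢g j) eq)))
  ... | t , θ , col = t , θ ∘ π , record
    { on⇒     = λ { (zero , refl) → θa≡t ; (suc i , refl) → on⇒ (i , refl) }
    ; ⇒on     = ⇒on′
    ; off-inj = off-inj′
    ; surj    = λ u → let y , eq = surj u in punchIn a y , trans (cong θ (π-surj y)) eq
    }
    where
    open Collapses col
    θa≡t : θ (π a) ≡ t
    θa≡t = on⇒ (zero , sym π-a)
    ⇒on′ : ∀ {c} → θ (π c) ≡ t → ∃ λ i → g i ≡ c
    ⇒on′ {c} eq = case a Fin.≟ c of λ
      { (yes a≡c) → zero , a≡c
      ; (no a≢c)  → let i , πeq = ⇒on eq in suc i , π-inj (a≢g i) a≢c πeq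
      }
    off-inj′ : ∀ {c c′} → θ (π c) ≡ θ (π c′) → c ≡ c′ ⊎ θ (π c) ≡ t
    off-inj′ {c} {c′} eq = case (a Fin.≟ c) , (a Fin.≟ c′) of λ
      { (yes refl , _)       → inj₂ θa≡t
      ; (no _ , yes refl)    → inj₂ (trans eq θa≡t)
      ; (no a≢c , no a≢c′) → case off-inj eq of λ
        { (inj₁ πeq) → inj₁ (π-inj a≢c a≢c′ πeq) ; (inj₂ θ≡t) → inj₂ θ≡t }
      }

_≟ˢ_ : DecidableEquality (Subset n)
_≟ˢ_ = ≡-dec Bool._≟_

-- Partitions as kernels of maps to finite sets.

ker : (A → B) → Partition A
ker f = record { _~_ = λ x y → f x ≡ f y ; isEquivalence = On.isEquivalence f isEquivalence }

≋-sym : ∀ (P Q : Partition A) → P ≋ Q → Q ≋ P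
≋-sym P Q e x y = Symmetry.equivalence (e x y)

≋-trans : ∀ (P Q R : Partition A) → P ≋ Q → Q ≋ R → P ≋ R
≋-trans P Q R e e′ x y = Compose.equivalence (e x y) (e′ x y)

Scattered-resp : ∀ {D : A → A → Pred ℕ 0ℓ} {s} (P Q : Partition A) → P ≋ Q → Scattered D s P → Scattered D s Q
Scattered-resp P Q P≋Q scat {x} {y} x~y = scat (Equivalence.from (P≋Q x y) x~y)

HasParts-ker : ∀ {m} (f : A → Fin m) → (∀ t → ∃ λ x → f x ≡ t) → HasParts m (ker f)
HasParts-ker f onto = record
  { to = f ; cong = id ; bijective = id , λ t → let x , fx≡t = onto t in x , λ fz≡fx → trans fz≡fx fx≡t }

-- Replacing a partition by a surjection onto `Fin m` lets the proof handle colours and labels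
-- instead of relations.
module Parts {m} (P : Partition A) (parts : HasParts m P) where
  part : A → Fin m
  part = Bijection.to parts

  ≋ker : P ≋ ker part
  ≋ker x y = mk⇔ (Bijection.cong parts) (Bijection.injective parts)

  onto : ∀ t → ∃ λ x → part x ≡ t
  onto t = let x , x-part = Bijection.surjective parts t in x , x-part (IsEquivalence.refl (Partition.isEquivalence P))

On : (Fin n → Fin κ) → Subset n → Pred (Fin κ) 0ℓ
On χ S c = ∃ λ x → x ∈ S × χ x ≡ c

on? : ∀ (χ : Fin n → Fin κ) S → Decidable (On χ S)
on? χ S c = any? λ x → (x ∈? S) ×-dec (χ x Fin.≟ c)

-- Required of every facet, this says that the colour classes are independent sets.
Rainbow : (Fin n → Fin κ) → Subset n → Set
Rainbow χ S = ∀ {x y} → x ∈ S → y ∈ S → χ x ≡ χ y → x ≡ y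

-- Facets of stacked complexes

module StackedComplex {n : ℕ} (X : SimplicialComplex n) (d : ℕ) (stacked : Stacked X d) where
  open SimplicialComplex X
  open Stacked stacked

  private
    module Order = Bijection order

  at : Fin (suc k) → Facet
  at = Order.to

  root : Facet
  root = at zero

  idx : Facet → Fin (suc k)
  idx f = proj₁ (Order.surjective f)

  at-idx : ∀ f → at (idx f) ≡ f
  at-idx f = proj₂ (Order.surjective f) refl

  idx-at : ∀ i → idx (at i) ≡ i
  idx-at i = Order.injective (at-idx (at i))

  idx-injective : ∀ {f g} → idx f ≡ idx g → f ≡ g
  idx-injective {f} {g} eq = trans (sym (at-idx f)) (trans (cong at eq) (at-idx g))

  infix 4 _≟ᶠ_
  _≟ᶠ_ : DecidableEquality Facet
  f ≟ᶠ g = map′ idx-injective (cong idx) (idx f Fin.≟ idx g)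

  any-facet? : ∀ {P : Pred Facet 0ℓ} → Decidable P → Dec (∃ P)
  any-facet? {P} P? = map′ (λ (i , p) → at i , p) (λ (f , p) → idx f , subst P (sym (at-idx f)) p)
    (any? (P? ∘ at))

  -- Vertices are added while the result remains a face. The fuel `b` satisfies `n ≤ ∣ f ∣ + b`, so
  -- once it is used up there is no vertex left to add.
  face⊆facet : ∀ {f} → Face f → ∃ λ (g : Facet) → f ⊆ value g
  face⊆facet {f} = grow {f} n (ℕ.m≤n+m n ∣ f ∣)
    where
    grow : ∀ {f} b → n ≤ ∣ f ∣ + b → Face f → ∃ λ (g : Facet) → f ⊆ value g
    grow {f} b bound Ff with any? (λ u → ¬? (u ∈? f) ×-dec face? (f ∪ ⁅ u ⁆))
    ... | no maximal = (f Refinement., [ Ff , max ]) , λ x∈f → x∈f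
      where
      max : ∀ {g} → Face g → f ⊆ g → g ⊆ f
      max {g} Fg f⊆g {x} x∈g with x ∈? f
      ... | yes x∈f = x∈f
      ... | no x∉f  = contradiction (x , x∉f , ⊆-closed f∪x⊆g Fg) maximal
        where
        f∪x⊆g : f ∪ ⁅ x ⁆ ⊆ g
        f∪x⊆g y∈ = case x∈p∪q⁻ f ⁅ x ⁆ y∈ of λ
          { (inj₁ y∈f) → f⊆g y∈f
          ; (inj₂ y∈x) → subst (_∈ g) (sym (x∈⁅y⁆⇒x≡y x y∈x)) x∈g
          }
    ... | yes (u , u∉f , Fg) = go b bound
      where
      larger : ∣ f ∣ < ∣ f ∪ ⁅ u ⁆ ∣
      larger = p⊂q⇒∣p∣<∣q∣ (p⊆p∪q ⁅ u ⁆ , u , q⊆p∪q f ⁅ u ⁆ (x∈⁅x⁆ u) , u∉f)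
      go : ∀ b → n ≤ ∣ f ∣ + b → ∃ λ (g : Facet) → f ⊆ value g
      go zero bound = contradiction (ℕ.<-≤-trans larger (∣p∣≤n (f ∪ ⁅ u ⁆)))
        (ℕ.≤⇒≯ (≤-trans bound (ℕ.≤-reflexive (ℕ.+-identityʳ _))))
      go (suc b) bound =
        let g , f∪u⊆g = grow {f ∪ ⁅ u ⁆} b (≤-trans bound (≤-trans (ℕ.≤-reflexive (ℕ.+-suc _ b)) (ℕ.+-monoˡ-≤ b larger))) Fg
        in g , λ x∈f → f∪u⊆g (p⊆p∪q ⁅ u ⁆ x∈f)

  in-facet : ∀ x → ∃ λ (f : Facet) → x ∈ value f
  in-facet x = let _ , Ff , x∈f = covers x ; g , f⊆g = face⊆facet Ff in g , f⊆g x∈f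

  first-facet : ∀ x → ∃ λ p → New p x
  first-facet x = case least first? (idx f , refl , subst (λ g → x ∈ value g) (sym (at-idx f)) x∈f) of λ
    { (_ , (p , refl , x∈p) , min) → p , x∈p , λ {j} j<p x∈j → ℕ.<⇒≱ j<p (min (j , refl , x∈j)) }
    where
    f = proj₁ (in-facet x)
    x∈f = proj₂ (in-facet x)
    first? : Decidable (λ m → ∃ λ p → toℕ p ≡ m × x ∈ F p)
    first? m = any? λ p → (toℕ p ℕ.≟ m) ×-dec (x ∈? F p)

  Adj : Facet → Facet → Set
  Adj f g = ∣ value f ∩ value g ∣ ≡ d

  Adj-sym : ∀ f g → Adj f g → Adj g f
  Adj-sym f g = trans (cong ∣_∣ (∩-comm (value g) (value f)))

  Adj-apex : ∀ f g → Adj f g →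
    ∃ λ a → a ∈ value f × a ∉ value g × (∀ {x} → x ∈ value f → x ∉ value g → x ≡ a)
  Adj-apex f g = apex (value f) (value g) (pure f)

  -- An intersection with `suc d` elements would be all of `f` and all of `g`, so distinct facets
  -- sharing `d` elements share no more.
  common-ridge⇒Adj : ∀ {f g e} → f ≢ g → ∣ e ∣ ≡ d → e ⊆ value f → e ⊆ value g → Adj f g
  common-ridge⇒Adj {f} {g} {e} f≢g ∣e∣ e⊆f e⊆g =
    ℕ.≤-antisym (s≤s⁻¹ (ℕ.≤∧≢⇒< (≤-trans (∣p∩q∣≤∣p∣ (value f) (value g)) (ℕ.≤-reflexive (pure f))) not-all))
      (≤-trans (ℕ.≤-reflexive (sym ∣e∣)) (p⊆q⇒∣p∣≤∣q∣ λ x∈e → x∈p∩q⁺ (e⊆f x∈e , e⊆g x∈e)))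
    where
    not-all : ∣ value f ∩ value g ∣ ≢ suc d
    not-all eq = f≢g (value-injective (⊆-antisym
      (p∩q⊆q (value f) (value g) ∘ p⊆q∧∣p∣≡∣q∣⇒q⊆p (p∩q⊆p (value f) (value g)) (trans eq (sym (pure f))))
      (p∩q⊆p (value f) (value g) ∘ p⊆q∧∣p∣≡∣q∣⇒q⊆p (p∩q⊆q (value f) (value g)) (trans eq (sym (pure g))))))

  -- Stages run from 1, where only the root is present, to `suc k`, where all facets are.
  Before : ℕ → Pred Facet 0ℓ
  Before m f = toℕ (idx f) < m

  -- The facet attached at step i, its new vertex v, and an earlier facet h containing the rest.
  module Attachment (i : Fin k) where
    private
      new    = proj₁ (proj₂ (attach i))
      parent = proj₂ (proj₂ (proj₂ (attach i)))

    j : Fin (suc k)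
    j = proj₁ parent

    j<g : j Fin.< suc i
    j<g = proj₁ (proj₂ parent)

    g h : Facet
    g = at (suc i)
    h = at j

    v : Fin n
    v = proj₁ (attach i)

    v∈g : v ∈ value g
    v∈g = proj₁ new

    v-fresh : ∀ {f} → Before (suc (toℕ i)) f → v ∉ value f
    v-fresh {f} f<g v∈f = proj₂ new f<g (subst (λ f → v ∈ value f) (sym (at-idx f)) v∈f)

    h-before : Before (suc (toℕ i)) h
    h-before = subst (λ q → toℕ q < suc (toℕ i)) (sym (idx-at j)) j<g

    v∉h : v ∉ value h
    v∉h = v-fresh h-before

    g-v⊆h : value g - v ⊆ value h
    g-v⊆h = proj₂ (proj₂ parent)

    new-unique : ∀ {x} → x ∈ value g → x ∉ value h → x ≡ v
    new-unique {x} x∈g x∉h = case x Fin.≟ v of λ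
      { (yes x≡v) → x≡v
      ; (no x≢v)  → contradiction (g-v⊆h (x∈p∧x≢y⇒x∈p-y x∈g x≢v)) x∉h
      }

    g∉before : ¬ Before (suc (toℕ i)) g
    g∉before g< = ℕ.<-irrefl (cong toℕ (idx-at (suc i))) g<

    before-suc : ∀ {f} → Before (suc (suc (toℕ i))) f → f ≡ g ⊎ Before (suc (toℕ i)) f
    before-suc {f} f< = case ℕ.m<1+n⇒m<n∨m≡n f< of λ
      { (inj₁ f<g) → inj₂ f<g
      ; (inj₂ eq)  → inj₁ (trans (sym (at-idx f)) (cong at (toℕ-injective eq)))
      }

    h~g : Adj h g
    h~g = common-ridge⇒Adj (λ h≡g → g∉before (subst (Before (suc (toℕ i))) h≡g h-before))
      (∣p-x∣ (value g) v∈g (pure g)) g-v⊆h (p─q⊆p (value g) ⁅ v ⁆)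

  -- The facet `h` may be any earlier one, hence well-founded recursion on the index.
  facet-induction : ∀ (P : Pred Facet 0ℓ) → P root →
    (∀ i → let open Attachment i in P h → P g) → ∀ f → P f
  facet-induction P P-root step f = subst P (at-idx f) (go (<-wellFounded (idx f)))
    where
    go : ∀ {p} → Acc Fin._<_ p → P (at p)
    go {zero}  _         = P-root
    go {suc i} (acc rec) = step i (go (rec (Attachment.j<g i)))

  -- Labellings

  -- A labelling of the facets before step m: Θ f sends the colours on f to the
  -- label of f, and a colour off f to the label of the facets carrying that
  -- colour that are first met when walking away from f.
  record Labelling (θ₀ : Fin κ → Fin ρ) (m : ℕ) (χ : Fin n → Fin κ) (ω : Facet → Fin ρ) : Set where
    field
      Θ         : Facet → Fin κ → Fin ρ
      rainbow   : ∀ {f} → Before m f → Rainbow χ (value f)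
      collapses : ∀ {f} → Before m f → Collapses (On χ (value f)) (ω f) (Θ f)
      agree     : ∀ {f g c} → Before m f → Before m g → Adj f g →
                  ¬ On χ (value f ∩ value g) c → Θ f c ≡ Θ g c
      -- Colours carried by no facet so far keep their initial value; this evaluates `Θ h` at the
      -- colour of a vertex that brings a new colour.
      unseen    : ∀ {f c} → Before m f → (∀ {g} → Before m g → ¬ On χ (value g) c) → Θ f c ≡ θ₀ c

  module _ {θ₀ : Fin κ → Fin ρ} {m : ℕ} {χ χ′ : Fin n → Fin κ} {ω ω′ : Facet → Fin ρ}
    (χ-eq : ∀ {f x} → Before m f → x ∈ value f → χ x ≡ χ′ x) (ω-eq : ∀ {f} → Before m f → ω f ≡ ω′ f) where

    -- A labelling constrains colours and labels only on the facets before step `m`, so it survives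
    -- assignments made for the next facet.
    Labelling-resp : Labelling θ₀ m χ ω → Labelling θ₀ m χ′ ω′
    Labelling-resp lab = record
      { Θ         = Θ
      ; rainbow   = λ f< x∈f y∈f eq →
          rainbow f< x∈f y∈f (trans (χ-eq f< x∈f) (trans eq (sym (χ-eq f< y∈f))))
      ; collapses = λ f< → subst (λ t → Collapses _ t _) (ω-eq f<)
          (Collapses-resp (fwd f< id) (bwd f< id) (collapses f<))
      ; agree     = λ {f} {g} f< g< adj off →
          agree f< g< adj (off ∘ fwd f< (p∩q⊆p (value f) (value g)))
      ; unseen    = λ f< off → unseen f< λ g< → off g< ∘ fwd g< id
      }
      where
      open Labelling lab
      fwd : ∀ {f S c} → Before m f → S ⊆ value f → On χ S c → On χ′ S c
      fwd f< S⊆f (x , x∈S , eq) = x , x∈S , trans (sym (χ-eq f< (S⊆f x∈S))) eq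
      bwd : ∀ {f S c} → Before m f → S ⊆ value f → On χ′ S c → On χ S c
      bwd f< S⊆f (x , x∈S , eq) = x , x∈S , trans (χ-eq f< (S⊆f x∈S)) eq

  module Extend (i : Fin k) {θ₀ : Fin κ → Fin ρ} {χ : Fin n → Fin κ} {ω : Facet → Fin ρ}
    (lab : Labelling θ₀ (suc (toℕ i)) χ ω) where
    open Attachment i
    open Labelling lab
    open Override _≟ᶠ_
    private
      module H = Collapses (collapses h-before)

    -- Passing from `h` to `g` exchanges the apex `a` of `h` for `v`. If their colours agree, `g`
    -- gets the label of `h` and nothing changes; otherwise the colour of `v` joins those on the
    -- ridge at the label of `g`, and the colour of `a` alone represents the label of `h`.
    extend : Rainbow χ (value g) → Θ h (χ v) ≡ ω g → Labelling θ₀ (suc (suc (toℕ i))) χ ω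
    extend g-rainbow Θhv≡ωg = record
      { Θ         = Θ′
      ; rainbow   = λ {f} f< → case before-suc {f} f< of λ
          { (inj₁ refl) → g-rainbow ; (inj₂ f<) → rainbow {f} f< }
      ; collapses = λ {f} f< → case before-suc {f} f< of λ
          { (inj₁ refl) → subst (Collapses (On χ (value g)) (ω g)) (sym Θ′-new) collapses-new
          ; (inj₂ f<)   → subst (Collapses (On χ (value f)) (ω f)) (sym (Θ′-old f<)) (collapses f<)
          }
      ; agree     = agree′
      ; unseen    = λ {f} {c} f< off → case before-suc {f} f< of λ
          { (inj₁ refl) → trans (cong (_$ c) Θ′-new)
              (trans (θ-off (off f<)) (unseen h-before (off ∘ ℕ.m<n⇒m<1+n)))
          ; (inj₂ f<)   → trans (cong (_$ c) (Θ′-old f<)) (unseen f< (off ∘ ℕ.m<n⇒m<1+n))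
          }
      }
      where
      θ-new : Fin κ → Fin ρ
      θ-new c = if does (on? χ (value g) c) then ω g else Θ h c

      Θ′ : Facet → Fin κ → Fin ρ
      Θ′ = override Θ g θ-new

      Θ′-new : Θ′ g ≡ θ-new
      Θ′-new = override-same Θ g θ-new

      Θ′-old : ∀ {f} → Before (suc (toℕ i)) f → Θ′ f ≡ Θ f
      Θ′-old f< = override-other Θ g θ-new λ { refl → g∉before f< }

      θ-on : ∀ {c} → On χ (value g) c → θ-new c ≡ ω g
      θ-on {c} on rewrite dec-true (on? χ (value g) c) on = refl

      θ-off : ∀ {c} → ¬ On χ (value g) c → θ-new c ≡ Θ h c
      θ-off {c} off rewrite dec-false (on? χ (value g) c) off = refl

      θ-cases : ∀ c → (On χ (value g) c × θ-new c ≡ ω g) ⊎ (¬ On χ (value g) c × θ-new c ≡ Θ h c)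
      θ-cases c = case on? χ (value g) c of λ
        { (yes on) → inj₁ (on , θ-on on) ; (no off) → inj₂ (off , θ-off off) }

      a = proj₁ (Adj-apex h g h~g)
      a∈h = proj₁ (proj₂ (Adj-apex h g h~g))
      a∉g = proj₁ (proj₂ (proj₂ (Adj-apex h g h~g)))
      apex-unique = proj₂ (proj₂ (proj₂ (Adj-apex h g h~g)))

      on-h-off-g : ∀ {c} → On χ (value h) c → ¬ On χ (value g) c → χ a ≡ c
      on-h-off-g {c} (x , x∈h , eq) off =
        trans (cong χ (sym (apex-unique x∈h λ x∈g → off (x , x∈g , eq)))) eq

      -- A vertex of `h` with the colour of `v` is not on `g`, because `g` is rainbow and `v` is not
      -- on `h`; so it is the apex.
      v-on-h : On χ (value h) (χ v) → χ a ≡ χ v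
      v-on-h (x , x∈h , eq) = trans (cong χ (sym (apex-unique x∈h x∉g))) eq
        where
        x∉g : x ∉ value g
        x∉g x∈g = v∉h (subst (_∈ value h) (g-rainbow x∈g v∈g eq) x∈h)

      ⇒on-new : ∀ {c} → θ-new c ≡ ω g → On χ (value g) c
      ⇒on-new {c} eq = case θ-cases c of λ
        { (inj₁ (on , _))  → on
        -- `Θ h` takes the same value at `c` and at the colour of `v`: either these are equal, or
        -- both are on `h` and then both are the colour of `a`.
        ; (inj₂ (off , e)) → case H.off-inj (trans (sym e) (trans eq (sym Θhv≡ωg))) of λ
          { (inj₁ refl) → v , v∈g , refl
          ; (inj₂ eq′) → v , v∈g , trans
              (sym (v-on-h (H.⇒on (trans Θhv≡ωg (trans (sym eq) (trans e eq′))))))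
              (on-h-off-g (H.⇒on eq′) off)
          }
        }

      off-inj-new : ∀ {c c′} → θ-new c ≡ θ-new c′ → c ≡ c′ ⊎ θ-new c ≡ ω g
      off-inj-new {c} {c′} eq = case θ-cases c of λ
        { (inj₁ (_ , e))   → inj₂ e
        ; (inj₂ (off , e)) → case θ-cases c′ of λ
          { (inj₁ (_ , e′)) → inj₂ (trans eq e′)
          ; (inj₂ (off′ , e′)) → case H.off-inj (trans (sym e) (trans eq e′)) of λ
            { (inj₁ c≡c′) → inj₁ c≡c′
            -- Two colours on `h` and off `g` are both the colour of `a`.
            ; (inj₂ eq′)  → inj₁ (trans (sym (on-h-off-g (H.⇒on eq′) off))
                (on-h-off-g (H.⇒on (trans (sym e′) (trans (sym eq) (trans e eq′)))) off′))
            }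
          }
        }

      a-on-g : On χ (value g) (χ a) → χ v ≡ χ a
      a-on-g (y , y∈g , eq) = trans (cong χ (sym (new-unique y∈g y∉h))) eq
        where
        y∉h : y ∉ value h
        y∉h y∈h = a∉g (subst (_∈ value g) (rainbow h-before y∈h a∈h eq) y∈g)

      surj-new : ∀ u → ∃ λ c → θ-new c ≡ u
      surj-new u with H.surj u
      ... | c , refl with θ-cases c
      ...   | inj₂ (_ , e)                  = c , e
      ...   | inj₁ ((x , x∈g , refl) , e) with x ∈? value h
      ...     | no x∉h  = c , trans e (trans (sym Θhv≡ωg) (cong (Θ h ∘ χ) (sym (new-unique x∈g x∉h))))
      -- Here `u` is the label of `h`. The colour of `a` still maps to it, being off `g` or equal to
      -- the colour of `v`.
      ...     | yes x∈h = χ a , trans θa≡Θa (trans (H.on⇒ (a , a∈h , refl)) (sym (H.on⇒ (x , x∈h , refl))))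
        where
        θa≡Θa : θ-new (χ a) ≡ Θ h (χ a)
        θa≡Θa = case θ-cases (χ a) of λ
          { (inj₁ (on , e)) → trans e (trans (sym Θhv≡ωg) (cong (Θ h) (a-on-g on)))
          ; (inj₂ (_ , e))  → e
          }

      collapses-new : Collapses (On χ (value g)) (ω g) θ-new
      collapses-new = record { on⇒ = θ-on ; ⇒on = ⇒on-new ; off-inj = off-inj-new ; surj = surj-new }

      -- Since `v` is on no earlier facet, every earlier neighbour `f` of `g` meets it in the same
      -- ridge as `h` does. So `f` is `h` or adjacent to `h` across that ridge, and the claim passes
      -- through `Θ h`.
      agree-new : ∀ {f c} → Before (suc (toℕ i)) f → Adj f g → ¬ On χ (value f ∩ value g) c → Θ f c ≡ θ-new c
      agree-new {f} {c} f< adj off = trans (Θf≡Θh (f ≟ᶠ h)) Θh≡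
        where
        f∩g⊆h : ∀ {x} → x ∈ value f ∩ value g → x ∈ value h
        f∩g⊆h x∈ = let x∈f , x∈g = x∈p∩q⁻ (value f) (value g) x∈ in
          g-v⊆h (x∈p∧x≢y⇒x∈p-y x∈g λ { refl → v-fresh f< x∈f })

        h∩g⊆f∩g : value h ∩ value g ⊆ value f ∩ value g
        h∩g⊆f∩g = p⊆q∧∣p∣≡∣q∣⇒q⊆p (λ x∈ → x∈p∩q⁺ (f∩g⊆h x∈ , p∩q⊆q (value f) (value g) x∈)) (trans adj (sym h~g))

        Θh≡ : Θ h c ≡ θ-new c
        Θh≡ with on? χ (value g) c
        ... | no _ = refl
        ... | yes (x , x∈g , refl) = trans (cong (Θ h ∘ χ) (new-unique x∈g λ x∈h →
                off (x , h∩g⊆f∩g (x∈p∩q⁺ (x∈h , x∈g)) , refl))) Θhv≡ωg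

        Θf≡Θh : Dec (f ≡ h) → Θ f c ≡ Θ h c
        Θf≡Θh (yes refl) = refl
        Θf≡Θh (no f≢h)   = agree f< h-before f~h λ (x , x∈ , eq) → off (x , f∩h⊆f∩g x∈ , eq)
          where
          f~h : Adj f h
          f~h = common-ridge⇒Adj f≢h adj (p∩q⊆p (value f) (value g)) f∩g⊆h
          f∩h⊆f∩g : value f ∩ value h ⊆ value f ∩ value g
          f∩h⊆f∩g = p⊆q∧∣p∣≡∣q∣⇒q⊆p (λ x∈ → x∈p∩q⁺ (p∩q⊆p (value f) (value g) x∈ , f∩g⊆h x∈)) (trans adj (sym f~h))

      agree′ : ∀ {f f′ c} → Before (suc (suc (toℕ i))) f → Before (suc (suc (toℕ i))) f′ → Adj f f′ →
        ¬ On χ (value f ∩ value f′) c → Θ′ f c ≡ Θ′ f′ c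
      agree′ {f} {f′} {c} f< f′< adj off = case before-suc {f} f< of λ
        { (inj₁ refl) → case before-suc {f′} f′< of λ
          { (inj₁ refl) → refl
          ; (inj₂ f′<)  → trans (cong (_$ c) Θ′-new) (sym (trans (cong (_$ c) (Θ′-old f′<))
              (agree-new f′< (Adj-sym g f′ adj) (subst (λ S → ¬ On χ S c) (∩-comm (value f) (value f′)) off))))
          }
        ; (inj₂ f<) → case before-suc {f′} f′< of λ
          { (inj₁ refl) → trans (cong (_$ c) (Θ′-old f<)) (trans (agree-new f< adj off) (sym (cong (_$ c) Θ′-new)))
          ; (inj₂ f′<)  → trans (cong (_$ c) (Θ′-old f<)) (trans (agree f< f′< adj off) (sym (cong (_$ c) (Θ′-old f′<))))
          }
        }

  -- Paths

  first-apex : ∀ {m} (fs : Vector Facet (2 + m)) → IsWalk X d fs → ∃ λ a →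
    a ∈ value (head fs) × a ∉ value (head (tail fs)) ×
    (∀ {x} → x ∈ value (head fs) → x ∉ value (head (tail fs)) → x ≡ a)
  first-apex fs walk = Adj-apex (head fs) (head (tail fs)) (walk zero)

  last-apex : ∀ {m} (fs : Vector Facet (2 + m)) → IsWalk X d fs → ∃ λ a →
    a ∈ value (last fs) × a ∉ value (last (init fs)) ×
    (∀ {x} → x ∈ value (last fs) → x ∉ value (last (init fs)) → x ≡ a)
  last-apex fs walk = Adj-apex (last fs) (last (init fs)) (Adj-sym (last (init fs)) (last fs) (walk (fromℕ _)))

  IsPath-init : ∀ {m} (fs : Vector Facet (2 + m)) → IsPath X d fs → IsPath X d (init fs)
  IsPath-init fs (walk , distinct) = walk ∘ inject₁ , Fin.inject₁-injective ∘ distinct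

  IsPath-tail : ∀ {m} (fs : Vector Facet (2 + m)) → IsPath X d fs → IsPath X d (tail fs)
  IsPath-tail fs (walk , distinct) = walk ∘ suc , Fin.suc-injective ∘ distinct

  -- The strict bound on the number of steps is the measure for the recursions that cut paths.
  record Path< (m : ℕ) (f g : Facet) : Set where
    constructor path<
    field
      {steps} : ℕ
      short   : steps < m
      facets  : Vector Facet (suc steps)
      isPath  : IsPath X d facets
      starts  : head facets ≡ f
      ends    : last facets ≡ g

  weaken : ∀ {m m′ f g} → m ≤ m′ → Path< m f g → Path< m′ f g
  weaken m≤m′ (path< short fs p s e) = path< (≤-trans short m≤m′) fs p s e

  prefix : ∀ {m} {fs : Vector Facet (suc m)} → IsPath X d fs → (i : Fin m) → Path< m (head fs) (fs (inject₁ i))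
  prefix {suc m} {fs} p i with view i
  ... | ‵fromℕ     = path< ≤-refl (init fs) (IsPath-init fs p) refl refl
  ... | ‵inj₁ {i = j} _ = weaken (ℕ.n≤1+n m) (prefix {m} {init fs} (IsPath-init fs p) j)

  suffix : ∀ {m} {fs : Vector Facet (suc m)} → IsPath X d fs → (i : Fin m) → Path< m (fs (suc i)) (last fs)
  suffix {suc m} {fs} p zero    = path< ≤-refl (tail fs) (IsPath-tail fs p) refl refl
  suffix {suc m} {fs} p (suc i) = weaken (ℕ.n≤1+n m) (suffix {m} {tail fs} (IsPath-tail fs p) i)

  -- If the ridge from f to the path reappears later, f is adjacent to a later facet of the path.
  prepend : ∀ {m f g h} → Adj f g → Path< m g h → Path< (suc m) f h
  prepend {suc m} {f} adj (path< {l} (s≤s l≤m) fs p refl refl) with any? (λ i → ridges X d fs i ≟ˢ (value f ∩ value (head fs)))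
  ... | no new = path< (s≤s (s≤s l≤m)) (f ◂ fs) (walk , distinct) refl refl
    where
    walk : IsWalk X d (f ◂ fs)
    walk zero    = adj
    walk (suc i) = proj₁ p i
    distinct : Injective _≡_ _≡_ (ridges X d (f ◂ fs))
    distinct {zero}  {zero}  _  = refl
    distinct {zero}  {suc j} eq = contradiction (j , sym eq) new
    distinct {suc i} {zero}  eq = contradiction (i , eq) new
    distinct {suc i} {suc j} eq = cong suc (proj₂ p eq)
  ... | yes (i , eq) with f ≟ᶠ fs (suc i)
  ...   | yes refl = weaken (≤-trans l≤m (≤-trans (ℕ.n≤1+n m) (ℕ.n≤1+n (suc m)))) (suffix {fs = fs} p i)
  ...   | no f≢    = weaken (s≤s (ℕ.n≤1+n m)) (prepend {m} f~ (weaken l≤m (suffix {fs = fs} p i)))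
    where
    f~ : Adj f (fs (suc i))
    f~ = common-ridge⇒Adj f≢ adj (p∩q⊆p (value f) (value (head fs)))
      λ x∈ → p∩q⊆q (value (fs (inject₁ i))) (value (fs (suc i))) (subst (_ ∈_) (sym eq) x∈)

  -- The path has at most as many steps as the walk, so it can stand in for a walk that realises a
  -- distance.
  shorten : ∀ {m} {fs : Vector Facet (suc m)} → IsWalk X d fs → Path< (suc m) (head fs) (last fs)
  shorten {zero}  {fs} walk = path< ≤-refl fs (walk , λ {}) refl refl
  shorten {suc m} {fs} walk = prepend (walk zero) (shorten {m} {tail fs} (walk ∘ suc))

  Joined : Facet → Facet → Set
  Joined e f = ∃ λ m → Path< m e f

  connected : ∀ e f → Joined e f
  connected e f = facet-induction (λ e → Joined e f)
    -- Paths grow only at their start, so the one from the root to `f` is built backwards, from `f`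
    -- through its ancestors.
    (facet-induction (λ e → Joined e f → Joined root f) id
      (λ i from-h g-f → from-h (step (Attachment.h~g i) g-f)) f
      (1 , path< ≤-refl (λ _ → f) ((λ ()) , λ {}) refl refl))
    (λ i → let open Attachment i in step (Adj-sym h g h~g)) e
    where
    step : ∀ {e e′} → Adj e e′ → Joined e′ f → Joined e f
    step adj (m , p) = suc m , prepend adj p

  -- Labellings of all facets: crossings, segments and links.

  module Complete {θ₀ : Fin κ → Fin ρ} {χ : Fin n → Fin κ} {ω : Facet → Fin ρ}
    (lab : Labelling θ₀ (suc k) χ ω) where
    open Labelling lab using (Θ)

    rainbow : ∀ f → Rainbow χ (value f)
    rainbow f = Labelling.rainbow lab {f} (toℕ<n (idx f))

    module Θ (f : Facet) = Collapses (Labelling.collapses lab {f} (toℕ<n (idx f)))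

    agree : ∀ f g {c} → Adj f g → ¬ On χ (value f ∩ value g) c → Θ f c ≡ Θ g c
    agree f g = Labelling.agree lab (toℕ<n (idx f)) (toℕ<n (idx g))

    agree-off : ∀ f g {c} → Adj f g → ¬ On χ (value f) c → Θ f c ≡ Θ g c
    agree-off f g adj off = agree f g adj λ (x , x∈ , eq) → off (x , p∩q⊆p (value f) (value g) x∈ , eq)

    -- By `agree-off`, the value at `c` can change only after a facet carrying `c`. The hypothesis
    -- may assume that the value is still `t`, since it is sometimes derived from labels instead of
    -- colours.
    carry : ∀ {m} (fs : Vector Facet (suc m)) → IsWalk X d fs → ∀ {c t} →
      (∀ i → Θ (fs (inject₁ i)) c ≡ t → ¬ On χ (value (fs (inject₁ i))) c) →
      Θ (head fs) c ≡ t → ∀ i → Θ (fs i) c ≡ t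
    carry fs walk off eq zero = eq
    carry {suc m} fs walk off eq (suc i) = carry (tail fs) (walk ∘ suc) (off ∘ suc)
      (trans (sym (agree-off _ _ (walk zero) (off zero eq))) eq) i

    module Crossing {m} (fs : Vector Facet (2 + m)) (walk : IsWalk X d fs) {v w}
      (v∈ : v ∈ value (head fs)) (v∉ : v ∉ value (head (tail fs)))
      (w∈ : w ∈ value (last fs)) (w∉ : w ∉ value (last (init fs))) where

      -- As the first facet is rainbow and `v` is off the first ridge, no vertex of that ridge has
      -- the colour of `v`, so `agree` applies.
      start : Θ (head (tail fs)) (χ v) ≡ ω (head fs)
      start = trans (sym (agree _ _ (walk zero) off)) (Θ.on⇒ (head fs) (v , v∈ , refl))
        where
        off : ¬ On χ (value (head fs) ∩ value (head (tail fs))) (χ v)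
        off (x , x∈ , eq) = let x∈0 , x∈1 = x∈p∩q⁻ (value (head fs)) _ x∈ in
          v∉ (subst (_∈ value (head (tail fs))) (rainbow (head fs) x∈0 v∈ eq) x∈1)

      colours⇒labels : χ v ≡ χ w → (∀ i → ¬ On χ (value (interior X d fs i)) (χ v)) →
        ω (head fs) ≡ ω (last fs) × (∀ i → ω (head fs) ≢ ω (interior X d fs i))
      colours⇒labels χv≡χw off =
        trans (sym (carried (fromℕ m))) (Θ.on⇒ (last fs) (w , w∈ , sym χv≡χw)) ,
        λ i eq → off i (Θ.⇒on (interior X d fs i) (trans (carried (inject₁ i)) eq))
        where
        carried = carry (tail fs) (walk ∘ suc) (λ i _ → off i) start

      -- An interior facet carrying the colour of `v` would have the label of the first facet. So
      -- the value is carried to the last facet, where it equals the label, and the colour must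
      -- occur there.
      labels⇒colours : ω (head fs) ≡ ω (last fs) → (∀ i → ω (head fs) ≢ ω (interior X d fs i)) →
        χ v ≡ χ w × (∀ i → ¬ On χ (value (interior X d fs i)) (χ v))
      labels⇒colours ωeq ω≢ = reached (Θ.⇒on (last fs) (trans (carried (fromℕ m)) ωeq)) , off
        where
        off-if : ∀ i → Θ (interior X d fs i) (χ v) ≡ ω (head fs) → ¬ On χ (value (interior X d fs i)) (χ v)
        off-if i eq on = ω≢ i (trans (sym eq) (Θ.on⇒ (interior X d fs i) on))
        carried = carry (tail fs) (walk ∘ suc) off-if start
        off : ∀ i → ¬ On χ (value (interior X d fs i)) (χ v)
        off i = off-if i (carried (inject₁ i))
        -- The facet before the last is the first one or an interior one. In the first case
        -- rainbowness gives `x ≡ v`, which contradicts `v∉`; in the second the colour does not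
        -- occur.
        last-ridge : ∀ m (fs : Vector Facet (2 + m)) → v ∈ value (head fs) → v ∉ value (head (tail fs)) →
          (∀ i → ¬ On χ (value (interior X d fs i)) (χ v)) →
          ∀ {x} → x ∈ value (last fs) → χ x ≡ χ v → x ∉ value (last (init fs))
        last-ridge zero    fs v∈ v∉ off x∈ eq x∈′ =
          v∉ (subst (_∈ value (last fs)) (rainbow (head fs) x∈′ v∈ eq) x∈)
        last-ridge (suc m) fs v∈ v∉ off x∈ eq x∈′ = off (fromℕ m) (_ , x∈′ , eq)
        reached : On χ (value (last fs)) (χ v) → χ v ≡ χ w
        reached (x , x∈ , eq) = trans (sym eq) (cong χ (trans (unique x∈ x∉) (sym (unique w∈ w∉))))
          where
          x∉ = last-ridge m fs v∈ v∉ off x∈ eq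
          unique = proj₂ (proj₂ (proj₂ (last-apex fs walk)))

    -- What is left when a path between equally labelled facets is cut wherever the label recurs.
    -- `short` bounds its number of steps, `suc m`, by `M`.
    record FacetSegment (M : ℕ) (f g : Facet) : Set where
      field
        {m}      : ℕ
        short    : m < M
        facets   : Vector Facet (2 + m)
        isPath   : IsPath X d facets
        starts   : head facets ≡ f
        ends     : last facets ≡ g
        distinct : f ≢ g
        labels   : ω f ≡ ω g
        clear    : ∀ i → ω f ≢ ω (interior X d facets i)

      ends-agree : ω (head facets) ≡ ω (last facets)
      ends-agree = trans (cong ω starts) (trans labels (cong ω (sym ends)))

      clear-from-head : ∀ i → ω (head facets) ≢ ω (interior X d facets i)
      clear-from-head i = clear i ∘ trans (cong ω (sym starts))

    -- While the label recurs inside, the path is cut there and both pieces are treated in turn; `b`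
    -- decreases and `M` stays fixed.
    facet-chain : ∀ {M f g} b → b ≤ suc M → Path< b f g → ω f ≡ ω g → Star (FacetSegment M) f g
    facet-chain {M} {f} {g} (suc b) b≤M (path< {l} (s≤s l≤b) fs p refl refl) eq with f ≟ᶠ g
    ... | yes f≡g = subst (Star (FacetSegment M) (head fs)) f≡g ε
    ... | no f≢g = go l l≤b fs p f≢g eq
      where
      go : ∀ l → l ≤ b → (fs : Vector Facet (suc l)) → IsPath X d fs → head fs ≢ last fs →
        ω (head fs) ≡ ω (last fs) → Star (FacetSegment M) (head fs) (last fs)
      go zero    l≤b fs p f≢g eq = contradiction refl f≢g
      go (suc m) l≤b fs p f≢g eq with any? (λ i → ω (head fs) Fin.≟ ω (interior X d fs i))
      ... | yes (i , eq′) =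
        -- The interior facet at `i` is both `fs (inject₁ (suc i))` and `fs (suc (inject₁ i))`,
        -- whence the two indices.
        facet-chain b (ℕ.<⇒≤ b≤M) (weaken l≤b (prefix {fs = fs} p (suc i))) eq′ ◅◅
        facet-chain b (ℕ.<⇒≤ b≤M) (weaken l≤b (suffix {fs = fs} p (inject₁ i))) (trans (sym eq′) eq)
      ... | no none = record
        { short = ≤-trans l≤b (s≤s⁻¹ b≤M) ; facets = fs ; isPath = p ; starts = refl ; ends = refl
        ; distinct = f≢g ; labels = eq ; clear = λ i eq → none (i , eq) } ◅ ε

    record VertexSegment (M : ℕ) (v w : Fin n) : Set where
      field
        {m}      : ℕ
        short    : m < M
        facets   : Vector Facet (2 + m)
        isPath   : IsPath X d facets
        starts   : v ∈ value (head facets)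
        leaves   : v ∉ value (head (tail facets))
        ends     : w ∈ value (last facets)
        enters   : w ∉ value (last (init facets))
        distinct : v ≢ w
        colours  : χ v ≡ χ w
        clear    : ∀ i → ¬ On χ (value (interior X d facets i)) (χ v)

    -- As for facets, except that an end facet is first dropped if its neighbour on the path also
    -- contains the end vertex.
    vertex-chain : ∀ {M f g v w} b → b ≤ suc M → Path< b f g → v ∈ value f → w ∈ value g →
      χ v ≡ χ w → Star (VertexSegment M) v w
    vertex-chain {M} {f} {g} {v} {w} (suc b) b≤M (path< {l} (s≤s l≤b) fs p refl refl) v∈ w∈ eq with v Fin.≟ w
    ... | yes refl = ε
    ... | no v≢w = go l l≤b fs p v∈ w∈
      where
      go : ∀ l → l ≤ b → (fs : Vector Facet (suc l)) → IsPath X d fs → v ∈ value (head fs) → w ∈ value (last fs) →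
        Star (VertexSegment M) v w
      go zero    l≤b fs p v∈ w∈ = contradiction (rainbow (head fs) v∈ w∈ eq) v≢w
      go (suc m) l≤b fs p v∈ w∈ with v ∈? value (head (tail fs))
      ... | yes v∈′ = vertex-chain b (ℕ.<⇒≤ b≤M) (weaken l≤b (suffix {fs = fs} p zero)) v∈′ w∈ eq
      ... | no v∉ with w ∈? value (last (init fs))
      ...   | yes w∈′ = vertex-chain b (ℕ.<⇒≤ b≤M) (weaken l≤b (prefix {fs = fs} p (fromℕ m))) v∈ w∈′ eq
      ...   | no w∉ with any? (λ i → on? χ (value (interior X d fs i)) (χ v))
      ...     | yes (i , u , u∈ , eq′) =
        vertex-chain b (ℕ.<⇒≤ b≤M) (weaken l≤b (prefix {fs = fs} p (suc i))) v∈ u∈ (sym eq′) ◅◅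
        vertex-chain b (ℕ.<⇒≤ b≤M) (weaken l≤b (suffix {fs = fs} p (inject₁ i))) u∈ w∈ (trans eq′ eq)
      ...     | no none = record
        { short = ≤-trans l≤b (s≤s⁻¹ b≤M) ; facets = fs ; isPath = p ; starts = v∈ ; leaves = v∉
        ; ends = w∈ ; enters = w∉ ; distinct = v≢w ; colours = eq ; clear = λ i on → none (i , on) } ◅ ε

    facet-segment⇒link : ∀ {M f g} → FacetSegment M f g → FacetLink X d (ker χ) f g
    facet-segment⇒link seg =
      let v , v∈ , v∉ , _ = first-apex facets (proj₁ isPath)
          w , w∈ , w∉ , _ = last-apex facets (proj₁ isPath)
          χv≡χw , off     = Crossing.labels⇒colours facets (proj₁ isPath) v∈ v∉ w∈ w∉ ends-agree clear-from-head
      in distinct , m , facets , isPath , starts , ends , v , w ,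
         x∈p∧x∉q⇒x∈p─q v∈ v∉ , x∈p∧x∉q⇒x∈p─q w∈ w∉ , χv≡χw , λ i {u} u∈ eq → off i (u , u∈ , sym eq)
      where open FacetSegment seg

    facet-link⇒label : ∀ {f g} → FacetLink X d (ker χ) f g → ω f ≡ ω g
    facet-link⇒label (_ , m , fs , (walk , _) , refl , refl , v , w , v∈ , w∈ , χv≡χw , off) =
      proj₁ (Crossing.colours⇒labels fs walk
        (p─q⊆p (value (head fs)) (value (head (tail fs))) v∈) (x∈p─q⇒x∉q (value (head fs)) (value (head (tail fs))) v∈)
        (p─q⊆p (value (last fs)) (value (last (init fs))) w∈) (x∈p─q⇒x∉q (value (last fs)) (value (last (init fs))) w∈)
        χv≡χw λ i (u , u∈ , eq) → off i u∈ (sym eq))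

    -- Links preserve labels by `Crossing`. Conversely, a path between facets with equal labels is
    -- cut into segments, and each segment is a link.
    Φ-ker : Φ X d (ker χ) ≋ ker ω
    Φ-ker f g = mk⇔ (EqClosure.fold (Partition.isEquivalence (ker ω)) facet-link⇒label) connect
      where
      connect : ω f ≡ ω g → EqClosure (FacetLink X d (ker χ)) f g
      connect eq = let m , p = connected f g in
        Star.map (SymClosure.return ∘ facet-segment⇒link) (facet-chain m (ℕ.n≤1+n m) p eq)

    vertex-segment⇒link : ∀ {M v w} → VertexSegment M v w → VertexLink X d (ker ω) v w
    vertex-segment⇒link {M} {v} {w} seg = distinct , apart , m , facets , between , crossed
      where
      open VertexSegment seg
      apart : ¬ ∃ λ (f : Facet) → v ∈ value f × w ∈ value f
      apart (f , v∈ , w∈) = distinct (rainbow f v∈ w∈ colours)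
      crossed = Crossing.colours⇒labels facets (proj₁ isPath) starts leaves ends enters colours clear
      between : IsPathBetween X d ⁅ v ⁆ ⁅ w ⁆ facets
      between = record
        { not-in-ridge = λ Fc _ vw⊆c → let f , c⊆f = face⊆facet Fc in
            apart (f , c⊆f (vw⊆c (p⊆p∪q ⁅ w ⁆ (x∈⁅x⁆ v))) , c⊆f (vw⊆c (q⊆p∪q ⁅ v ⁆ ⁅ w ⁆ (x∈⁅x⁆ w))))
        ; isPath       = isPath
        ; starts       = x∈p⇒⁅x⁆⊆p starts
        ; ends         = x∈p⇒⁅x⁆⊆p ends
        ; leavesEnds   =
            (λ v⊆ → leaves (p∩q⊆q (value (head facets)) (value (head (tail facets))) (v⊆ (x∈⁅x⁆ v)))) ,
            (λ w⊆ → enters (p∩q⊆p (value (last (init facets))) (value (last facets)) (w⊆ (x∈⁅x⁆ w))))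
        }

    vertex-link⇒colour : ∀ {v w} → VertexLink X d (ker ω) v w → χ v ≡ χ w
    vertex-link⇒colour {v} {w} (_ , _ , m , fs , between , ωeq , ω≢) =
      proj₁ (Crossing.labels⇒colours fs (proj₁ isPath) v∈ v∉ w∈ w∉ ωeq ω≢)
      where
      open IsPathBetween between
      v∈ = starts (x∈⁅x⁆ v)
      w∈ = ends (x∈⁅x⁆ w)
      v∉ : v ∉ value (head (tail fs))
      v∉ v∈′ = proj₁ leavesEnds (x∈p⇒⁅x⁆⊆p (x∈p∩q⁺ (v∈ , v∈′)))
      w∉ : w ∉ value (last (init fs))
      w∉ w∈′ = proj₂ leavesEnds (x∈p⇒⁅x⁆⊆p (x∈p∩q⁺ (w∈′ , w∈)))

    Ψ-ker : Ψ X d (ker ω) ≋ ker χ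
    Ψ-ker v w = mk⇔ (EqClosure.fold (Partition.isEquivalence (ker χ)) vertex-link⇒colour) connect
      where
      connect : χ v ≡ χ w → EqClosure (VertexLink X d (ker ω)) v w
      connect eq =
        let f , v∈f = in-facet v
            g , w∈g = in-facet w
            m , p   = connected f g
        in Star.map (SymClosure.return ∘ vertex-segment⇒link) (vertex-chain m (ℕ.n≤1+n m) p v∈f w∈g eq)

    -- On a walk from the root to a facet carrying `c`, the value at `c` is constant up to the first
    -- facet carrying `c`, and is the label of that facet.
    colours-onto⇒labels-onto : (∀ c → ∃ λ x → χ x ≡ c) → ∀ t → ∃ λ f → ω f ≡ t
    colours-onto⇒labels-onto χ-onto t
      with c , refl ← Θ.surj root t
      with x , refl ← χ-onto c
      with f , x∈f ← in-facet x
      with _ , path< _ fs (walk , _) start refl ← connected root f =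
        subst (λ f → ∃ λ g → ω g ≡ Θ f (χ x)) start (meet fs walk x∈f)
      where
      meet : ∀ {m x} (fs : Vector Facet (suc m)) → IsWalk X d fs → x ∈ value (last fs) → ∃ λ g → ω g ≡ Θ (head fs) (χ x)
      meet {zero}      fs walk x∈ = head fs , sym (Θ.on⇒ (head fs) (_ , x∈ , refl))
      meet {suc m} {x} fs walk x∈ with on? χ (value (head fs)) (χ x)
      ... | yes on = head fs , sym (Θ.on⇒ (head fs) on)
      ... | no off = let g , eq = meet (tail fs) (walk ∘ suc) x∈ in
        g , trans eq (sym (agree-off _ _ (walk zero) off))

    -- On a walk to a facet labelled `Θ root c`, either `c` occurs before the end, or the value
    -- persists and `⇒on` puts `c` on the last facet.
    labels-onto⇒colours-onto : (∀ t → ∃ λ f → ω f ≡ t) → ∀ c → ∃ λ x → χ x ≡ c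
    labels-onto⇒colours-onto ω-onto c
      with f , eq ← ω-onto (Θ root c)
      with _ , path< _ fs (walk , _) start refl ← connected root f =
        meet fs walk (trans (cong (λ f → Θ f c) start) (sym eq))
      where
      meet : ∀ {m} (fs : Vector Facet (suc m)) → IsWalk X d fs → Θ (head fs) c ≡ ω (last fs) → ∃ λ x → χ x ≡ c
      meet {zero}  fs walk eq = let x , _ , χx≡c = Θ.⇒on (head fs) eq in x , χx≡c
      meet {suc m} fs walk eq with on? χ (value (head fs)) c
      ... | yes (x , _ , χx≡c) = x , χx≡c
      ... | no off = meet (tail fs) (walk ∘ suc) (trans (sym (agree-off _ _ (walk zero) off)) eq)

  -- Distances

  -- `Scattered` demands actual minima; deciding walks of each length lets `least` find them.
  walk? : ∀ m f g → Dec (FacetWalk X d f g m)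
  walk? zero f g = map′ (λ { refl → (λ _ → f) , (λ ()) , refl , refl }) (λ { (fs , _ , refl , refl) → refl }) (f ≟ᶠ g)
  walk? (suc m) f g = map′ cons uncons (any-facet? λ e → (∣ value f ∩ value e ∣ ℕ.≟ d) ×-dec walk? m e g)
    where
    cons : (∃ λ e → Adj f e × FacetWalk X d e g m) → FacetWalk X d f g (suc m)
    cons (_ , adj , fs , walk , refl , end) = f ◂ fs , (λ { zero → adj ; (suc i) → walk i }) , refl , end
    uncons : FacetWalk X d f g (suc m) → ∃ λ e → Adj f e × FacetWalk X d e g m
    uncons (fs , walk , refl , end) = head (tail fs) , walk zero , tail fs , walk ∘ suc , refl , end

  vertex-walk? : ∀ v w → Decidable (VertexWalk X d v w)
  vertex-walk? v w zero    = no λ { (_ , () , _) }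
  vertex-walk? v w (suc m) = map′
    (λ { (f , v∈ , g , w∈ , fs , walk , refl , refl) → m , refl , fs , walk , v∈ , w∈ })
    (λ { (_ , refl , fs , walk , v∈ , w∈) → head fs , v∈ , last fs , w∈ , fs , walk , refl , refl })
    (any-facet? λ f → (v ∈? value f) ×-dec any-facet? λ g → (w ∈? value g) ×-dec walk? m f g)

  facet-dist : ∀ f g → ∃ (FacetDist X d f g)
  facet-dist f g = let _ , path< _ fs (walk , _) start end = connected f g in
    least (λ m → walk? m f g) (fs , walk , start , end)

  vertex-dist : ∀ v w → ∃ (VertexDist X d v w)
  vertex-dist v w with f , v∈ ← in-facet v | g , w∈ ← in-facet w
    with _ , path< _ fs (walk , _) refl refl ← connected f g =
    least (vertex-walk? v w) (_ , refl , fs , walk , v∈ , w∈)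

  -- Existence of labellings

  before-1⇒root : ∀ {f} → Before 1 f → f ≡ root
  before-1⇒root f< = idx-injective (trans (toℕ-injective (ℕ.n<1⇒n≡0 f<)) (sym (idx-at zero)))

  Labelling-root : {θ₀ : Fin κ → Fin ρ} {χ : Fin n → Fin κ} {ω : Facet → Fin ρ} →
    Rainbow χ (value root) → Collapses (On χ (value root)) (ω root) θ₀ → Labelling θ₀ 1 χ ω
  Labelling-root {θ₀ = θ₀} {χ} {ω} rb col = record
    { Θ         = λ _ → θ₀
    ; rainbow   = λ {f} f< → subst (Rainbow χ ∘ value) (sym (before-1⇒root f<)) rb
    ; collapses = λ {f} f< → subst (λ f → Collapses (On χ (value f)) (ω f) θ₀) (sym (before-1⇒root f<)) col
    ; agree     = λ _ _ _ _ → refl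
    ; unseen    = λ _ _ → refl
    }

  step-induction : ∀ (P : Pred ℕ 0ℓ) → P 1 → (∀ (i : Fin k) → P (suc (toℕ i)) → P (suc (suc (toℕ i)))) → P (suc k)
  step-induction P P1 step = subst (P ∘ suc) (Fin.toℕ-fromℕ k)
    (<-weakInduction (P ∘ suc ∘ toℕ) P1 (λ i p → step i (subst (P ∘ suc) (Fin.toℕ-inject₁ i) p)) (fromℕ k))

  New-unique : ∀ {p q x} → New p x → New q x → p ≡ q
  New-unique {p} {q} (x∈p , p-new) (x∈q , q-new) with Fin.<-cmp p q
  ... | tri< p<q _ _ = contradiction x∈p (q-new p<q)
  ... | tri≈ _ p≡q _ = p≡q
  ... | tri> _ _ q<p = contradiction x∈q (p-new q<p)

  birth : Fin n → Fin (suc k)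
  birth x = proj₁ (first-facet x)

  birth-New : ∀ x → New (birth x) x
  birth-New x = proj₂ (first-facet x)

  New⇒birth : ∀ {p x} → New p x → birth x ≡ p
  New⇒birth = New-unique (birth-New _)

  -- All colours and all labels are distinct.  Crossing a walk that leaves v and
  -- re-enters v would identify the labels of its ends, whence apexes-distinct: this
  -- is how connectedness of the star of v enters.
  identity-labelling : Labelling birth (suc k) id idx
  identity-labelling = step-induction (λ m → Labelling birth m id idx)
    (Labelling-root (λ _ _ → id) (Collapses-at-root (sym (idx-at zero))))
    λ i lab → let open Attachment i in
      Extend.extend i lab (λ _ _ → id)
        -- No earlier facet contains `v`, so the value of `Θ h` at `v` is still `birth v`, the index
        -- of `g`.
        (trans (Labelling.unseen lab h-before λ { g< (_ , v∈ , refl) → v-fresh g< v∈ })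
          (trans (New⇒birth (new i)) (sym (idx-at (suc i)))))
    where
    new : ∀ i → New (suc i) (Attachment.v i)
    new i = proj₁ (proj₂ (attach i))
    root-New : ∀ {x} → x ∈ value root → New zero x
    root-New x∈ = x∈ , λ ()
    Collapses-at-root : ∀ {t} → zero ≡ t → Collapses (On id (value root)) t birth
    Collapses-at-root refl = record
      { on⇒     = λ { (_ , x∈ , refl) → New⇒birth (root-New x∈) }
      ; ⇒on     = λ {x} eq → x , subst (λ p → x ∈ F p) eq (proj₁ (birth-New x)) , refl
      ; off-inj = λ {x} {y} eq → off-inj (birth-New x) (subst (λ p → New p y) (sym eq) (birth-New y))
      ; surj    = surj
      }
      where
      off-inj : ∀ {p x y} → New p x → New p y → x ≡ y ⊎ p ≡ zero
      off-inj {zero}  _  _  = inj₂ refl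
      off-inj {suc i} xn yn = let uniq = proj₁ (proj₂ (proj₂ (attach i))) in inj₁ (trans (uniq xn) (sym (uniq yn)))
      surj : ∀ u → ∃ λ x → birth x ≡ u
      surj zero    = let e , _ , e∈ , _ = enumerate (value root) (pure root) in e zero , New⇒birth (root-New (e∈ zero))
      surj (suc i) = Attachment.v i , New⇒birth (new i)

  apexes-distinct : ∀ {m} (fs : Vector Facet (2 + m)) → IsWalk X d fs → head fs ≢ last fs → ∀ {v w} →
    v ∈ value (head fs) → v ∉ value (head (tail fs)) → w ∈ value (last fs) → w ∉ value (last (init fs)) →
    (∀ i → v ∉ value (interior X d fs i)) → v ≢ w
  apexes-distinct fs walk f≢g v∈ v∉ w∈ w∉ off refl = f≢g (idx-injective (proj₁
    (Complete.Crossing.colours⇒labels identity-labelling fs walk v∈ v∉ w∈ w∉ refl λ { i (_ , v∈i , refl) → off i v∈i })))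

  -- The root carries `suc d` of the `ρ + d` colours; contracting them leaves `ρ` labels. Every
  -- later label is then forced by `Extend`.
  label-facets : ∀ {χ : Fin n → Fin κ} → κ ≡ ρ + d → (∀ f → Rainbow χ (value f)) →
    ∃ λ θ₀ → ∃ λ (ω : Facet → Fin ρ) → Labelling θ₀ (suc k) χ ω
  label-facets {ρ = ρ} {χ} κ≡ρ+d rainbow =
    let e , e-inj , e∈ , e-onto = enumerate (value root) (pure root)
        t , θ₀ , col = collapse d κ≡ρ+d (χ ∘ e) (e-inj ∘ rainbow root (e∈ _) (e∈ _))
    in θ₀ , step-induction (λ m → ∃ (Labelling θ₀ m χ))
      ((λ _ → t) , Labelling-root (rainbow root) (Collapses-resp
        (λ (i , eq) → e i , e∈ i , eq)
        (λ { (x , x∈ , refl) → let i , eq = e-onto x∈ in i , cong χ eq }) col))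
      extend-label
    where
    extend-label : ∀ {θ₀} (i : Fin k) → ∃ (Labelling θ₀ (suc (toℕ i)) χ) → ∃ (Labelling {ρ = ρ} θ₀ (suc (suc (toℕ i))) χ)
    extend-label i (ω , lab) = ω′ , Extend.extend i
      (Labelling-resp (λ _ _ → refl) (λ f< → sym (override-other ω g t λ { refl → g∉before f< })) lab)
      (rainbow g) (sym (override-same ω g t))
      where
      open Attachment i
      open Override _≟ᶠ_
      t = Labelling.Θ lab h (χ v)
      ω′ = override ω g t

  -- The colours are a copy of the labels together with `d` extra ones. The root gets the copy of
  -- `t` and all extra colours, and `θ₀` sends the extra colours to `t`.
  colour-root : ∀ {κ} → κ ≡ ρ + d → (t : Fin ρ) →
    ∃ λ (χ : Fin n → Fin κ) → Rainbow χ (value root) × ∃ (Collapses (On χ (value root)) t)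
  colour-root {ρ} refl t = χ , χ-rainbow , θ₀ , record
    { on⇒     = on⇒
    ; ⇒on     = λ {c} eq → case split c of λ
        { (inj₁ (u , refl)) → x₀ , x₀∈ , trans χ-x₀ (cong (Fin._↑ˡ d) (trans (sym eq) (θ₀-↑ˡ u)))
        ; (inj₂ (i , refl)) → e (suc i) , e∈ (suc i) , χ-e (suc i)
        }
    ; off-inj = λ {c} {c′} eq → case split c of λ
        { (inj₂ (i , refl)) → inj₂ (θ₀-↑ʳ i)
        ; (inj₁ (u , refl)) → case split c′ of λ
          { (inj₂ (i , refl))  → inj₂ (trans eq (θ₀-↑ʳ i))
          ; (inj₁ (u′ , refl)) → inj₁ (cong (Fin._↑ˡ d) (trans (sym (θ₀-↑ˡ u)) (trans eq (θ₀-↑ˡ u′))))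
          }
        }
    ; surj    = λ u → u Fin.↑ˡ d , θ₀-↑ˡ u
    }
    where
    enum = enumerate (value root) (pure root)
    e = proj₁ enum
    e-inj = proj₁ (proj₂ enum)
    e∈ = proj₁ (proj₂ (proj₂ enum))
    e-onto = proj₂ (proj₂ (proj₂ enum))
    x₀ = e zero
    x₀∈ = e∈ zero

    disjoint : ∀ u i → u Fin.↑ˡ d ≢ ρ Fin.↑ʳ i
    disjoint u i eq = case trans (sym (Fin.splitAt-↑ˡ ρ u d)) (trans (cong (Fin.splitAt ρ) eq) (Fin.splitAt-↑ʳ ρ d i)) of λ ()

    colour : Fin (suc d) → Fin (ρ + d)
    colour zero    = t Fin.↑ˡ d
    colour (suc i) = ρ Fin.↑ʳ i

    colour-inj : Injective _≡_ _≡_ colour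
    colour-inj {zero}  {zero}  _  = refl
    colour-inj {zero}  {suc j} eq = contradiction eq (disjoint t j)
    colour-inj {suc i} {zero}  eq = contradiction (sym eq) (disjoint t i)
    colour-inj {suc i} {suc j} eq = cong suc (Fin.↑ʳ-injective ρ i j eq)

    χ : Fin n → Fin (ρ + d)
    χ x with any? (λ i → e i Fin.≟ x)
    ... | yes (i , _) = colour i
    -- A placeholder: vertices off the root are recoloured when they are attached.
    ... | no _        = t Fin.↑ˡ d

    χ-e : ∀ i → χ (e i) ≡ colour i
    χ-e i with any? (λ j → e j Fin.≟ e i)
    ... | yes (j , eq) = cong colour (e-inj eq)
    ... | no none      = contradiction (i , refl) none

    χ-x₀ : χ x₀ ≡ t Fin.↑ˡ d
    χ-x₀ = χ-e zero

    χ-rainbow : Rainbow χ (value root)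
    χ-rainbow x∈ y∈ eq with i , refl ← e-onto x∈ | j , refl ← e-onto y∈ =
      cong e (colour-inj (trans (sym (χ-e i)) (trans eq (χ-e j))))

    θ₀ : Fin (ρ + d) → Fin ρ
    θ₀ = [ id , (λ _ → t) ]′ ∘ Fin.splitAt ρ

    θ₀-↑ˡ : ∀ u → θ₀ (u Fin.↑ˡ d) ≡ u
    θ₀-↑ˡ u = cong [ id , (λ _ → t) ]′ (Fin.splitAt-↑ˡ ρ u d)

    θ₀-↑ʳ : ∀ i → θ₀ (ρ Fin.↑ʳ i) ≡ t
    θ₀-↑ʳ i = cong [ id , (λ _ → t) ]′ (Fin.splitAt-↑ʳ ρ d i)

    split : ∀ c → (∃ λ u → u Fin.↑ˡ d ≡ c) ⊎ (∃ λ i → ρ Fin.↑ʳ i ≡ c)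
    split c with Fin.splitAt ρ c | Fin.join-splitAt ρ d c
    ... | inj₁ u | eq = inj₁ (u , eq)
    ... | inj₂ i | eq = inj₂ (i , eq)

    on⇒ : ∀ {c} → On χ (value root) c → θ₀ c ≡ t
    on⇒ (x , x∈ , refl) with e-onto x∈
    ... | zero  , refl = trans (cong θ₀ χ-x₀) (θ₀-↑ˡ t)
    ... | suc i , refl = trans (cong θ₀ (χ-e (suc i))) (θ₀-↑ʳ i)

  -- Now the label of `g` is given, and `v` gets a colour that `Θ h` sends to it. A choice off the
  -- ridge keeps `g` rainbow.
  colour-vertices : ∀ {κ} {ω : Facet → Fin ρ} → κ ≡ ρ + d →
    ∃ λ θ₀ → ∃ λ (χ : Fin n → Fin κ) → Labelling θ₀ (suc k) χ ω
  colour-vertices {ω = ω} κ≡ρ+d =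
    let χ₀ , rb , θ₀ , col = colour-root κ≡ρ+d (ω root)
    in θ₀ , step-induction (λ m → ∃ λ χ → Labelling θ₀ m χ ω) (χ₀ , Labelling-root rb col) extend-colour
    where
    extend-colour : ∀ {θ₀} (i : Fin k) → (∃ λ χ → Labelling θ₀ (suc (toℕ i)) χ ω) →
      ∃ λ χ → Labelling θ₀ (suc (suc (toℕ i))) χ ω
    extend-colour i (χ , lab) = χ′ , Extend.extend i
      (Labelling-resp (λ {f} f< x∈ → sym (χ′-old λ { refl → v-fresh f< x∈ })) (λ _ → refl) lab)
      g-rainbow (trans (cong (Θ h) χ′-new) (proj₁ (proj₂ choice)))
      where
      open Attachment i
      open Labelling lab
      open Override (Fin._≟_ {n})
      module H = Collapses (collapses h-before)

      -- If all preimages of the label of g lay on the common ridge, the colour of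
      -- the apex of h would be one off it.
      choice : ∃ λ c → Θ h c ≡ ω g × ¬ On χ (value h ∩ value g) c
      choice with H.surj (ω g)
      ... | c , eq with on? χ (value h ∩ value g) c
      ...   | no off = c , eq , off
      ...   | yes (x , x∈ , refl) with Adj-apex h g h~g
      ...     | a , a∈h , a∉g , _ = χ a ,
        trans (H.on⇒ (a , a∈h , refl)) (trans (sym (H.on⇒ (x , p∩q⊆p (value h) (value g) x∈ , refl))) eq) ,
        λ (y , y∈ , eq′) → let y∈h , y∈g = x∈p∩q⁻ (value h) (value g) y∈ in
          a∉g (subst (_∈ value g) (rainbow h-before y∈h a∈h eq′) y∈g)

      c = proj₁ choice
      off = proj₂ (proj₂ choice)
      χ′ = override χ v c

      χ′-new : χ′ v ≡ c
      χ′-new = override-same χ v c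

      χ′-old : ∀ {x} → x ≢ v → χ′ x ≡ χ x
      χ′-old = override-other χ v c

      old∈h : ∀ {x} → x ∈ value g → x ≢ v → x ∈ value h
      old∈h x∈g x≢v = g-v⊆h (x∈p∧x≢y⇒x∈p-y x∈g x≢v)

      c-unused : ∀ {x} → x ∈ value g → x ≢ v → χ′ x ≢ c
      c-unused x∈g x≢v eq = off (_ , x∈p∩q⁺ (old∈h x∈g x≢v , x∈g) , trans (sym (χ′-old x≢v)) eq)

      g-rainbow : Rainbow χ′ (value g)
      g-rainbow {x} {y} x∈ y∈ eq = by-cases (x Fin.≟ v) (y Fin.≟ v)
        where
        by-cases : Dec (x ≡ v) → Dec (y ≡ v) → x ≡ y
        by-cases (yes x≡v)  (yes y≡v) = trans x≡v (sym y≡v)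
        by-cases (yes refl) (no y≢v)  = contradiction (trans (sym eq) χ′-new) (c-unused y∈ y≢v)
        by-cases (no x≢v)  (yes refl) = contradiction (trans eq χ′-new) (c-unused x∈ x≢v)
        by-cases (no x≢v)  (no y≢v)   = rainbow h-before (old∈h x∈ x≢v) (old∈h y∈ y≢v)
          (trans (sym (χ′-old x≢v)) (trans eq (χ′-old y≢v)))

  -- The correspondence

  module Transfer {θ₀ : Fin κ → Fin ρ} {χ : Fin n → Fin κ} {ω : Facet → Fin ρ}
    (lab : Labelling θ₀ (suc k) χ ω) (s : ℕ) where
    open Complete lab

    -- Every segment of a chain obeys the same length bound, so any one of them serves to compare
    -- distances.
    some-step : ∀ {A : Set} {R : Rel A 0ℓ} {x y} → Star R x y → x ≢ y → ∃ λ u → ∃ λ v → R u v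
    some-step ε       x≢x = contradiction refl x≢x
    some-step (r ◅ _) _   = _ , _ , r

    -- A shortest walk from `f` to `g` yields a segment with at most `M` steps. From apex to apex it
    -- is a walk of `2 + m` facets between vertices of one colour, so `s ≤ suc m ≤ M`.
    facets-scattered : Scattered (VertexDist X d) (suc s) (ker χ) → Scattered (FacetDist X d) s (ker ω)
    facets-scattered scat {f} {g} ωf≡ωg f≢g with facet-dist f g
    ... | M , (fs , walk , refl , refl) , min
      with _ , _ , seg ← some-step (facet-chain (suc M) ≤-refl (shorten {fs = fs} walk) ωf≡ωg) f≢g =
      let v , v∈ , v∉ , _ = first-apex facets (proj₁ isPath)
          w , w∈ , w∉ , _ = last-apex facets (proj₁ isPath)
          χv≡χw , off = Crossing.labels⇒colours facets (proj₁ isPath) v∈ v∉ w∈ w∉ ends-agree clear-from-head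
          -- Scatteredness bounds only distances between distinct vertices.
          v≢w = apexes-distinct facets (proj₁ isPath) (λ eq → distinct (trans (sym starts) (trans eq ends)))
                  v∈ v∉ w∈ w∉ (λ i v∈i → off i (v , v∈i , refl))
          _ , (_ , min′) , s<k = scat χv≡χw v≢w
      in M , ((fs , walk , refl , refl) , min) ,
         ≤-trans (s≤s⁻¹ (≤-trans s<k (min′ (_ , refl , facets , proj₁ isPath , v∈ , w∈)))) short
      where open FacetSegment seg

    -- The ends of a segment are distinct facets with one label: a common facet would contain two
    -- vertices of one colour. The shift by one reflects that vertex distance counts facets and
    -- facet distance counts steps.
    vertices-scattered : Scattered (FacetDist X d) s (ker ω) → Scattered (VertexDist X d) (suc s) (ker χ)
    vertices-scattered scat {v} {w} χv≡χw v≢w with vertex-dist v w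
    ... | _ , (M , refl , fs , walk , v∈ , w∈) , min
      with _ , _ , seg ← some-step (vertex-chain (suc M) ≤-refl (shorten {fs = fs} walk) v∈ w∈ χv≡χw) v≢w =
      let ωeq , _ = Crossing.colours⇒labels facets (proj₁ isPath) starts leaves ends enters colours clear
          _ , (_ , min′) , s≤k = scat ωeq λ eq →
            distinct (rainbow (head facets) starts (subst (λ f → _ ∈ value f) (sym eq) ends) colours)
      in suc M , ((M , refl , fs , walk , v∈ , w∈) , min) ,
         s≤s (≤-trans s≤k (≤-trans (min′ (facets , proj₁ isPath , refl , refl)) short))
      where open VertexSegment seg

  Φ-cong : ∀ (P Q : Partition (Fin n)) → P ≋ Q → Φ X d P ≋ Φ X d Q
  Φ-cong P Q P≋Q f g = mk⇔ (EqClosure.map (along P Q P≋Q)) (EqClosure.map (along Q P (≋-sym P Q P≋Q)))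
    where
    along : ∀ P Q → P ≋ Q → ∀ {f g} → FacetLink X d P f g → FacetLink X d Q f g
    along P Q P≋Q (f≢g , m , fs , p , start , end , v , w , v∈ , w∈ , v~w , off) =
      f≢g , m , fs , p , start , end , v , w , v∈ , w∈ , Equivalence.to (P≋Q v w) v~w ,
      λ i {u} u∈ → off i u∈ ∘ Equivalence.from (P≋Q v u)

  Ψ-cong : ∀ (P Q : Partition Facet) → P ≋ Q → Ψ X d P ≋ Ψ X d Q
  Ψ-cong P Q P≋Q v w = mk⇔ (EqClosure.map (along P Q P≋Q)) (EqClosure.map (along Q P (≋-sym P Q P≋Q)))
    where
    along : ∀ P Q → P ≋ Q → ∀ {v w} → VertexLink X d P v w → VertexLink X d Q v w
    along P Q P≋Q (v≢w , apart , m , fs , p , f~g , off) =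
      v≢w , apart , m , fs , p , Equivalence.to (P≋Q _ _) f~g , λ i → off i ∘ Equivalence.from (P≋Q _ _)

  -- Vertices of a common facet have a walk of one facet, and 1 is less than `suc s`.
  scattered⇒rainbow : ∀ {s} {χ : Fin n → Fin κ} → 1 ≤ s → Scattered (VertexDist X d) (suc s) (ker χ) →
    ∀ f → Rainbow χ (value f)
  scattered⇒rainbow 1≤s scat f {x} {y} x∈ y∈ eq with x Fin.≟ y
  ... | yes x≡y = x≡y
  ... | no x≢y  = let _ , (_ , min) , s<k = scat eq x≢y in
    contradiction (s≤s⁻¹ (≤-trans s<k (min (0 , refl , (λ _ → f) , (λ ()) , x∈ , y∈)))) (ℕ.<⇒≱ 1≤s)

  module Correspondence (r s : ℕ) (1≤s : 1 ≤ s) where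
    open Setoid (VertexPartitions X d (r + d) (suc s)) using () renaming (Carrier to 𝕍)
    open Setoid (FacetPartitions X d r s) using () renaming (Carrier to 𝔽)

    -- The result is the kernel of a labelling, for which the number of parts and scatteredness are
    -- available; `Φ-ker` and `Ψ-ker` relate it to `Φ X d P` and recover `P`.
    to-facets : ∀ ((P , _) : 𝕍) → Σ[ (Q , _) ∈ 𝔽 ] (Q ≋ Φ X d P) × (Ψ X d Q ≋ P)
    to-facets (P , parts , scat) =
      let θ₀ , ω , lab = label-facets refl (scattered⇒rainbow 1≤s scat′)
          open Complete lab
      in (ker ω , HasParts-ker ω (colours-onto⇒labels-onto onto) , Transfer.facets-scattered lab s scat′) ,
         ≋-sym (Φ X d P) (ker ω)
           (≋-trans (Φ X d P) (Φ X d (ker part)) (ker ω) (Φ-cong P (ker part) ≋ker) Φ-ker) ,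
         ≋-trans (Ψ X d (ker ω)) (ker part) P Ψ-ker (≋-sym P (ker part) ≋ker)
      where
      open Parts P parts
      scat′ : Scattered (VertexDist X d) (suc s) (ker part)
      scat′ = Scattered-resp P (ker part) ≋ker scat

    to-vertices : ∀ ((Q , _) : 𝔽) → Σ[ (P , _) ∈ 𝕍 ] (P ≋ Ψ X d Q) × (Φ X d P ≋ Q)
    to-vertices (Q , parts , scat) =
      let θ₀ , χ , lab = colour-vertices {ω = part} refl
          open Complete lab
      in (ker χ , HasParts-ker χ (labels-onto⇒colours-onto onto) ,
          Transfer.vertices-scattered lab s (Scattered-resp Q (ker part) ≋ker scat)) ,
         ≋-sym (Ψ X d Q) (ker χ)
           (≋-trans (Ψ X d Q) (Ψ X d (ker part)) (ker χ) (Ψ-cong Q (ker part) ≋ker) Ψ-ker) ,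
         ≋-trans (Φ X d (ker χ)) (ker part) Q Φ-ker (≋-sym Q (ker part) ≋ker)
      where open Parts Q parts

    to : 𝕍 → 𝔽
    to = proj₁ ∘ to-facets

    from : 𝔽 → 𝕍
    from = proj₁ ∘ to-vertices

    to≋Φ : ∀ 𝒱 → proj₁ (to 𝒱) ≋ Φ X d (proj₁ 𝒱)
    to≋Φ 𝒱 = proj₁ (proj₂ (to-facets 𝒱))

    from≋Ψ : ∀ 𝓕 → proj₁ (from 𝓕) ≋ Ψ X d (proj₁ 𝓕)
    from≋Ψ 𝓕 = proj₁ (proj₂ (to-vertices 𝓕))

    -- Both the congruence of `to` and one of the inverse laws are instances.
    ≋⇒to≋ : ∀ 𝒱 P 𝓕 → proj₁ 𝒱 ≋ P → Φ X d P ≋ 𝓕 → proj₁ (to 𝒱) ≋ 𝓕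
    ≋⇒to≋ 𝒱 P 𝓕 𝒱≋P ΦP≋𝓕 = ≋-trans (proj₁ (to 𝒱)) (Φ X d (proj₁ 𝒱)) 𝓕 (to≋Φ 𝒱)
      (≋-trans (Φ X d (proj₁ 𝒱)) (Φ X d P) 𝓕 (Φ-cong (proj₁ 𝒱) P 𝒱≋P) ΦP≋𝓕)

    ≋⇒from≋ : ∀ 𝓕 Q 𝒱 → proj₁ 𝓕 ≋ Q → Ψ X d Q ≋ 𝒱 → proj₁ (from 𝓕) ≋ 𝒱
    ≋⇒from≋ 𝓕 Q 𝒱 𝓕≋Q ΨQ≋𝒱 = ≋-trans (proj₁ (from 𝓕)) (Ψ X d (proj₁ 𝓕)) 𝒱 (from≋Ψ 𝓕)
      (≋-trans (Ψ X d (proj₁ 𝓕)) (Ψ X d Q) 𝒱 (Ψ-cong (proj₁ 𝓕) Q 𝓕≋Q) ΨQ≋𝒱)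

    inverse : Inverse (VertexPartitions X d (r + d) (suc s)) (FacetPartitions X d r s)
    inverse = record
      { to        = to
      ; from      = from
      ; to-cong   = λ {𝒱} {𝒱′} 𝒱≋𝒱′ → ≋⇒to≋ 𝒱 (proj₁ 𝒱′) (proj₁ (to 𝒱′)) 𝒱≋𝒱′
          (≋-sym (proj₁ (to 𝒱′)) (Φ X d (proj₁ 𝒱′)) (to≋Φ 𝒱′))
      ; from-cong = λ {𝓕} {𝓕′} 𝓕≋𝓕′ → ≋⇒from≋ 𝓕 (proj₁ 𝓕′) (proj₁ (from 𝓕′)) 𝓕≋𝓕′
          (≋-sym (proj₁ (from 𝓕′)) (Ψ X d (proj₁ 𝓕′)) (from≋Ψ 𝓕′))
      ; inverse   =
          (λ {𝓕} {𝒱} 𝒱≋ → ≋⇒to≋ 𝒱 (proj₁ (from 𝓕)) (proj₁ 𝓕) 𝒱≋ (proj₂ (proj₂ (to-vertices 𝓕)))) ,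
          (λ {𝒱} {𝓕} 𝓕≋ → ≋⇒from≋ 𝓕 (proj₁ (to 𝒱)) (proj₁ 𝒱) 𝓕≋ (proj₂ (proj₂ (to-facets 𝒱))))
      }

theorem3p6 : ∀ {n : ℕ} (X : SimplicialComplex n) (d : ℕ) → Stacked X d →
    ∀ (r s : ℕ) → 1 ≤ r → 1 ≤ s →
    Σ[ φ ∈ Inverse (VertexPartitions X d (r + d) (suc s)) (FacetPartitions X d r s) ]
    (∀ 𝒱 → proj₁ (Inverse.to φ 𝒱) ≋ Φ X d (proj₁ 𝒱)) ×
    (∀ 𝓕 → proj₁ (Inverse.from φ 𝓕) ≋ Ψ X d (proj₁ 𝓕))
theorem3p6 X d stacked r s _ 1≤s =
  inverse , to≋Φ , from≋Ψ
  where
  open StackedComplex X d stacked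
  open Correspondence r s 1≤s
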